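{- With $\delta(c)$ as defined in the context, \[ \delta(4)=\tfrac12(\sqrt{13}+5),\qquad \delta(5)=\tfrac12(\sqrt{24}+6),\qquad \delta(6)=\tfrac12(\sqrt{37}+7). \]
   Context: For integers $\ell,c\ge 1$ let $W(\ell,c)$ be the set of sequences $\alpha=(\alpha_1,\dots,\alpha_d)$ of length $d=\ell+c-2$ with entries in $\{1,2\}$ having exactly $\ell-1$ entries equal to $1$ and $c-1$ entries equal to $2$. For $0\le i\le d$ and $s\in\{1,2\}$ let $\nu_{i,s}:=1+|\{1\le j\le i:\alpha_j=s\}|$. Define integers recursively: $x_{1,0}:=x_{2,0}:=0$, and for $i=0,1,\dots,d$ in turn let $k_i:=1+\sum_{s\in\{1,2\}}\min_{j_1,j_2\ge 0,\ j_1+j_2=\nu_{i,s}-1}(x_{s,j_1}+x_{s,j_2})$, and, if $i<d$, set $x_{s,\nu_{i,s}}:=k_i$ for $s=\alpha_{i+1}$ (all values used are defined at that time). This defines $x_{1,0},\dots,x_{1,\ell-1}$ and $x_{2,0},\dots,x_{2,c-1}$. Put $\beta(\alpha):=1+\min_{j_1,j_2\ge0,\ j_1+j_2=c-1}(x_{2,j_1}+x_{2,j_2})$ and $\delta(\alpha):=\min_{0\le j\le \ell-1}\frac{x_{1,j}+\beta(\alpha)}{j+1}$. Finally $\delta(1):=1$ and, for $c\ge 2$, $\delta(c):=\sup\{\delta(\alpha): \ell\ge 1,\ \alpha\in W(\ell,c),\ \alpha_{\ell+c-2}=2\}$. -}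

module Defs where

open import Data.Nat as ℕ using (ℕ; zero; suc; _∸_; _≥_)
open import Data.Integer using (+_)
open import Data.Rational using (ℚ; _/_; _⊓_; _+_; _-_; _*_; _≤_; _<_; 0ℚ)
open import Data.List using (List; []; _∷_; _++_; [_]; reverse; zipWith; length; last)
open import Data.Maybe using (just)
open import Data.Product using (_×_; Σ)
open import Data.Sum using (_⊎_)
open import Relation.Binary.PropositionalEquality using (_≡_)

data Letter : Set where
  l1 l2 : Letter

count : Letter → List Letter → ℕ
count s [] = 0
count l1 (l1 ∷ xs) = suc (count l1 xs)
count l1 (l2 ∷ xs) = count l1 xs
count l2 (l1 ∷ xs) = count l2 xs
count l2 (l2 ∷ xs) = suc (count l2 xs)

InW : ℕ → ℕ → List Letter → Set
InW ℓ c α = (length α ≡ ℓ ℕ.+ c ∸ 2) × (count l1 α ≡ ℓ ∸ 1) × (count l2 α ≡ c ∸ 1)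

-- minimum of a list of naturals (only applied to nonempty lists)
minList : List ℕ → ℕ
minList [] = 0
minList (x ∷ []) = x
minList (x ∷ y ∷ ys) = x ℕ.⊓ minList (y ∷ ys)

-- For xs = [x_0,…,x_{n-1}] (n ≥ 1):  min_{j1+j2=n-1} (x_{j1} + x_{j2})
minPair : List ℕ → ℕ
minPair xs = minList (zipWith ℕ._+_ xs (reverse xs))

-- The state (x_{1,0..}, x_{2,0..}) as lists; the length of the list for s is ν_{i,s}.
record State : Set where
  constructor st
  field
    xs1 : List ℕ
    xs2 : List ℕ
open State public

kOf : State → ℕ
kOf (st a b) = suc (minPair a ℕ.+ minPair b)

-- step i → i+1 with letter s = α_{i+1}: set x_{s,ν_{i,s}} := k_i
step : State → Letter → State
step σ@(st a b) l1 = st (a ++ [ kOf σ ]) b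
step σ@(st a b) l2 = st a (b ++ [ kOf σ ])

run : State → List Letter → State
run σ [] = σ
run σ (s ∷ α) = run (step σ s) α

finalState : List Letter → State
finalState α = run (st [ 0 ] [ 0 ]) α

β : List Letter → ℕ
β α = suc (minPair (xs2 (finalState α)))

minRatio : ℕ → ℕ → List ℕ → ℚ
minRatio b j [] = 0ℚ
minRatio b j (x ∷ []) = + (x ℕ.+ b) / suc j
minRatio b j (x ∷ y ∷ ys) = (+ (x ℕ.+ b) / suc j) ⊓ minRatio b (suc j) (y ∷ ys)

δα : List Letter → ℚ
δα α = minRatio (β α) 0 (xs1 (finalState α))

InSet : ℕ → List Letter → Set
InSet c α = Σ ℕ λ ℓ → (ℓ ≥ 1) × InW ℓ c α × (last α ≡ just l2)

-- Comparisons of a rational q with the real number r = (√a + b)/2: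
-- q ≤ r  ⟺  2q − b ≤ 0  or  (2q − b)² ≤ a
LeHalfSqrt : ℕ → ℕ → ℚ → Set
LeHalfSqrt a b q = let t = (+ 2 / 1) * q - (+ b / 1) in (t ≤ 0ℚ) ⊎ (t * t ≤ (+ a / 1))

-- r < q  ⟺  2q − b > 0  and  (2q − b)² > a
HalfSqrtLt : ℕ → ℕ → ℚ → Set
HalfSqrtLt a b q = let t = (+ 2 / 1) * q - (+ b / 1) in (0ℚ < t) × ((+ a / 1) < t * t)

-- δ(c) = (√a + b)/2, i.e. (√a+b)/2 is the supremum of {δ(α) : α ∈ InSet c}:
-- it is an upper bound, and for every rational ε > 0 some δ(α) exceeds it minus ε.
DeltaEq : ℕ → ℕ → ℕ → Set
DeltaEq c a b =
  ((α : List Letter) → InSet c α → LeHalfSqrt a b (δα α)) ×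
  ((ε : ℚ) → 0ℚ < ε → Σ (List Letter) λ α → InSet c α × HalfSqrtLt a b (δα α + ε))

-- Put X n = 1 + x_{1,n-1}, and let A ≤ s ≤ u be the numbers of values x_{1,j}
-- present when the first three letters 2 occur.  Then X (a + b) ≤ M + X a + X b,
-- where M = 0 up to index A, M = A up to s and M = 2 A up to u.  This bounds X,
-- x_{2,2}, x_{2,3} and B = β − 1 from above, and q n ≤ X n + B for n = A ⌊s / A⌋,
-- s and u (and a few other n that exclude the non-extremal shapes) combine to
-- f² + 2 f ≤ r f + 3 r, where f = q − 3 and r = c − 3; the positive root of this
-- quadratic is δ(c) − 3.  Conversely, for the word 1^(A−1) 2 1^C 2 1^C 2^(c−3)
-- every x_{2,p} is at least (p − 1) s + A, where s = A + C, and
-- q = 3 + r s / A as long as s / A stays below the positive root; taking C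
-- maximal, 3 + r (s + 1) / A is already beyond δ(c).
module Submission where

open import Defs
open import Data.Empty using (⊥; ⊥-elim)
open import Data.Integer as ℤ using (ℤ; +_; -[1+_])
import Data.Integer.Properties as ℤ
import Data.Integer.Tactic.RingSolver as ℤSolver
open import Data.List using (List; []; _∷_; _++_; [_]; last; length; replicate; reverse; take; zipWith)
open import Data.List.Properties using (length-take; length-++; length-reverse; length-zipWith; take-all; unfold-reverse; ++-assoc; ++-identityʳ)
open import Data.Maybe using (just)
open import Data.Nat
open import Data.Nat.DivMod using (m≡m%n+[m/n]*n; m%n<n)
open import Data.Nat.Properties
open import Data.Nat.Tactic.RingSolver using (solve)
open import Data.Product using (_×_; ∃-syntax; _,_; proj₁; proj₂)
open import Data.Rational as ℚ using (ℚ; mkℚ; 0ℚ; toℚᵘ)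
import Data.Rational.Properties as ℚ
open import Data.Rational.Unnormalised as ℚᵘ using (mkℚᵘ; *≤*; *<*; *≡*)
import Data.Rational.Unnormalised.Properties as ℚᵘ
open import Data.Sum using (inj₁; inj₂)
open import Relation.Binary.PropositionalEquality hiding ([_])
open import Relation.Nullary using (yes; no)

-- The two shifts by one cancel: the leading 1 of the recursion disappears from the inequality for X
-- (a + b), and x_{1,n-1} + β equals X n + B. The costs M are bounds for the pair minima of the
-- second sequence while it has one, two or three entries: 0, x_{2,1} and 2 x_{2,1}, with x_{2,1} ≤
-- A. For c ≤ 6 an index pair with sum c - 1 can be taken among 1, 2, 3, so the first three letters
-- 2 are enough to bound B. The quadratic is a balance of two ratios. In the extremal shape X s = s
-- + A and B = r s + 2 A; the ratio at A gives f = r s / A, and the ratio at s, multiplied by r / A,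
-- then reads f² + 2 f ≤ r f + 3 r. The obstacle is that s and u need not be multiples of A: an
-- incomplete part costs as much as a full one. Evaluation at A ⌊s / A⌋ avoids this loss.

-- Upper bounds on X and the quadratic inequality

-- A linear inequality L ≤ R is certified by a known a ≤ b and a slack with
-- L + b + slack ≡ R + a, an identity that the ring solver checks.
linear : ∀ {a b L R} slack → a ≤ b → L + b + slack ≡ R + a → L ≤ R
linear {a} {b} {L} {R} slack a≤b eq = +-cancelʳ-≤ b L R (begin
  L + b          ≤⟨ m≤m+n (L + b) slack ⟩
  L + b + slack  ≡⟨ eq ⟩
  R + a          ≤⟨ +-monoʳ-≤ R a≤b ⟩
  R + b          ∎)
  where open ≤-Reasoning

absurd : ∀ {a b} slack → a ≤ b → a ≡ suc (b + slack) → ⊥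
absurd {a} {b} slack a≤b eq = <⇒≱ (s≤s (m≤m+n b slack)) (subst (_≤ b) eq a≤b)

infixl 6 _⊕_
infixr 7 _⊗_

_⊕_ : ∀ {a b c d} → a ≤ b → c ≤ d → a + c ≤ b + d
_⊕_ = +-mono-≤

_⊗_ : ∀ {a b} c → a ≤ b → c * a ≤ c * b
c ⊗ h = *-monoʳ-≤ c h

split-< : ∀ {a n} → a < n → ∃[ b ] 1 ≤ b × n ≡ a + b
split-< {a} {n} a<n = n ∸ a , m<n⇒0<n∸m a<n , sym (m+[n∸m]≡n (<⇒≤ a<n))

division : ∀ {A} n → 1 ≤ A → ∃[ k ] k * A ≤ n × n < suc k * A
division {A@(suc _)} n _ = n / A , lower , upper
  where
  lower : n / A * A ≤ n
  lower = subst (n / A * A ≤_) (sym (m≡m%n+[m/n]*n n A)) (m≤n+m (n / A * A) (n % A))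
  upper : n < A + n / A * A
  upper = subst (_< A + n / A * A) (sym (m≡m%n+[m/n]*n n A)) (+-monoˡ-< (n / A * A) (m%n<n n A))

record Profile (X : ℕ → ℕ) (A s u y₂ y₃ : ℕ) : Set where
  field
    1≤A : 1 ≤ A
    A≤s : A ≤ s
    s≤u : s ≤ u
    X-base : ∀ n → 1 ≤ n → n ≤ A → X n ≤ n
    join₁ : ∀ {a b} → 1 ≤ a → 1 ≤ b → a + b ≤ s → X (a + b) ≤ A + (X a + X b)
    join₂ : ∀ {a b} → 1 ≤ a → 1 ≤ b → a + b ≤ u → X (a + b) ≤ 2 * A + (X a + X b)
    y₂-bound : ∀ {a b} → 1 ≤ a → 1 ≤ b → a + b ≡ suc s → suc y₂ ≤ A + (X a + X b)
    y₃-bound : ∀ {a b} → 1 ≤ a → 1 ≤ b → a + b ≡ suc u → suc y₃ ≤ 2 * A + (X a + X b)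

module Bounds {X A s u y₂ y₃} (profile : Profile X A s u y₂ y₃) where
  open Profile profile

  A≤u : A ≤ u
  A≤u = ≤-trans A≤s s≤u

  1≤s : 1 ≤ s
  1≤s = ≤-trans 1≤A A≤s

  -- Cutting off a part of length `A` costs `A`, and `j` cuts bring `n` down to at most `A`, where
  -- `X-base` adds no cost.
  X-layer : ∀ j n → 1 ≤ n → n ≤ s → n ≤ suc j * A → X n ≤ n + j * A
  X-layer zero n 1≤n n≤s n≤A =
    ≤-trans (X-base n 1≤n (subst (n ≤_) (+-identityʳ A) n≤A)) (m≤m+n n 0)
  X-layer (suc j) n 1≤n n≤s n≤jA with n ≤? A
  ... | yes n≤A = ≤-trans (X-base n 1≤n n≤A) (m≤m+n n _)
  ... | no n≰A with split-< (≰⇒> n≰A)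
  ...   | b , 1≤b , refl = linear 0
    (join₁ 1≤A 1≤b n≤s ⊕ X-base A 1≤A ≤-refl
      ⊕ X-layer j b 1≤b (≤-trans (m≤n+m b A) n≤s) (+-cancelˡ-≤ A _ _ n≤jA))
    (ident A b j (X (A + b)) (X A) (X b))
    where
    ident : ∀ A b j x y z →
      x + (A + (y + z) + A + (b + j * A)) + 0 ≡ A + b + suc j * A + (x + y + z)
    ident A b j x y z = solve (A ∷ b ∷ j ∷ x ∷ y ∷ z ∷ [])

  module _ (j : ℕ) (K≤s : suc j * A ≤ s) (s<K+A : s < suc (suc j) * A) where

    K : ℕ
    K = suc j * A

    1≤K : 1 ≤ K
    1≤K = ≤-trans 1≤A (m≤m+n A _)

    X-K : X K ≤ K + j * A
    X-K = X-layer j K 1≤K K≤s ≤-refl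

    X-s : X s ≤ s + K
    X-s = X-layer (suc j) s 1≤s ≤-refl (<⇒≤ s<K+A)

    -- The total to be split is s + 1, yet the bound is the one of `X-s`: removing `A` from s + 1
    -- leaves at most `K`, because s < K + A.
    y₂≤ : y₂ ≤ s + K
    y₂≤ with split-< (s≤s A≤s)
    ... | b , 1≤b , eq = linear 0
      (y₂-bound 1≤A 1≤b (sym eq) ⊕ X-base A 1≤A ≤-refl ⊕ X-layer j b 1≤b b≤s b≤K ⊕ ≤-reflexive (sym eq))
      (ident A b j s y₂ (X A) (X b))
      where
      b≤s : b ≤ s
      b≤s = +-cancelˡ-≤ 1 b s (≤-trans (+-monoˡ-≤ b 1≤A) (≤-reflexive (sym eq)))
      b≤K : b ≤ K
      b≤K = +-cancelˡ-≤ A b K (subst (_≤ A + K) eq s<K+A)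
      ident : ∀ A b j s y x z →
        y + (A + (x + z) + A + (b + j * A) + suc s) + 0 ≡ s + suc j * A + (suc y + x + z + (A + b))
      ident A b j s y x z = solve (A ∷ b ∷ j ∷ s ∷ y ∷ x ∷ z ∷ [])

    -- Every n ≤ u + 1 beyond K is K plus a part of length at most s, so a single join
    -- of cost 2 A suffices; ⌊u / A⌋ = suc j + e.
    module Near (e : ℕ) (u<s+K : u < s + K) (u<lA+A : u < K + suc e * A) where

      y₃≤ : y₃ ≤ u + (2 + j + e) * A
      y₃≤ with split-< (s≤s (≤-trans K≤s s≤u))
      ... | b , 1≤b , eq = linear 0
        (y₃-bound 1≤K 1≤b (sym eq) ⊕ X-K ⊕ X-layer e b 1≤b b≤s b≤eA ⊕ ≤-reflexive (sym eq))
        (ident A b j e u y₃ (X K) (X b))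
        where
        b≤s : b ≤ s
        b≤s = +-cancelˡ-≤ K b s (subst₂ _≤_ eq (+-comm s K) u<s+K)
        b≤eA : b ≤ suc e * A
        b≤eA = +-cancelˡ-≤ K b _ (subst (_≤ K + suc e * A) eq u<lA+A)
        ident : ∀ A b j e u y x z →
          y + (2 * A + (x + z) + (suc j * A + j * A) + (b + e * A) + suc u) + 0
            ≡ u + (2 + j + e) * A + (suc y + x + z + (suc j * A + b))
        ident A b j e u y x z = solve (A ∷ b ∷ j ∷ e ∷ u ∷ y ∷ x ∷ z ∷ [])

      X-u : X u ≤ u + (2 + j + e) * A
      X-u with u ≤? K
      -- Here u = s = K, and no second part is left to join.
      ... | yes u≤K = ≤-trans (X-layer j u (≤-trans 1≤s s≤u) (≤-trans u≤K K≤s) u≤K)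
                        (+-monoʳ-≤ u (*-monoˡ-≤ A (≤-trans (m≤n+m j 2) (m≤m+n (2 + j) e))))
      ... | no u≰K with split-< (≰⇒> u≰K)
      ...   | b , 1≤b , eq = linear 0
        (≤-reflexive (cong X eq) ⊕ join₂ 1≤K 1≤b (≤-reflexive (sym eq)) ⊕ X-K
          ⊕ X-layer e b 1≤b b≤s b≤eA ⊕ ≤-reflexive (sym eq))
        (ident A b j e u (X u) (X (K + b)) (X K) (X b))
        where
        b≤s : b ≤ s
        b≤s = +-cancelˡ-≤ K b s (subst₂ _≤_ eq (+-comm s K) (<⇒≤ u<s+K))
        b≤eA : b ≤ suc e * A
        b≤eA = +-cancelˡ-≤ K b _ (subst (_≤ K + suc e * A) eq (<⇒≤ u<lA+A))
        ident : ∀ A b j e u y w x z →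
          y + (w + (2 * A + (x + z)) + (suc j * A + j * A) + (b + e * A) + u) + 0
            ≡ u + (2 + j + e) * A + (y + w + x + z + (suc j * A + b))
        ident A b j e u y w x z = solve (A ∷ b ∷ j ∷ e ∷ u ∷ y ∷ w ∷ x ∷ z ∷ [])

      -- A multiple of `A` has no incomplete part, which improves the bound of `X-u` by one `A`; e ≥
      -- 1 makes the second part nonempty.
      X-multiple : ∀ d → e ≡ suc d → K + e * A ≤ u → X (K + e * A) ≤ 2 * (K + e * A)
      X-multiple d refl lA≤u = linear 0
        (join₂ 1≤K 1≤dA lA≤u ⊕ X-K ⊕ X-layer d (suc d * A) 1≤dA dA≤s ≤-refl)
        (ident A j d (X (K + suc d * A)) (X K) (X (suc d * A)))
        where
        1≤dA : 1 ≤ suc d * A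
        1≤dA = ≤-trans 1≤A (m≤m+n A _)
        dA≤s : suc d * A ≤ s
        dA≤s = +-cancelˡ-≤ K _ s (≤-trans lA≤u (subst (u ≤_) (+-comm s K) (<⇒≤ u<s+K)))
        ident : ∀ A j d y x z →
          y + (2 * A + (x + z) + (suc j * A + j * A) + (suc d * A + d * A)) + 0
            ≡ 2 * (suc j * A + suc d * A) + (y + x + z)
        ident A j d y x z = solve (A ∷ j ∷ d ∷ y ∷ x ∷ z ∷ [])

    -- When u ≥ s + K, cutting into chunks of length K wastes the least.
    X-chunks : ∀ n → suc n * K ≤ u → X (suc n * K) ≤ suc n * (K + j * A) + n * (2 * A)
    X-chunks zero _ = subst₂ (λ a b → X a ≤ b) (sym (*-identityˡ K)) (ident A j) X-K
      where
      ident : ∀ A j → suc j * A + j * A ≡ 1 * (suc j * A + j * A) + 0 * (2 * A)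
      ident A j = solve (A ∷ j ∷ [])
    X-chunks (suc n) nK≤u = linear 0
      (join₂ 1≤K (≤-trans 1≤K (m≤m+n K _)) nK≤u ⊕ X-K ⊕ X-chunks n (≤-trans (m≤n+m _ K) nK≤u))
      (ident A j n (X (suc (suc n) * K)) (X K) (X (suc n * K)))
      where
      ident : ∀ A j n y x z →
        y + (2 * A + (x + z) + (suc j * A + j * A) + (suc n * (suc j * A + j * A) + n * (2 * A))) + 0
          ≡ suc (suc n) * (suc j * A + j * A) + suc n * (2 * A) + (y + x + z)
      ident A j n y x z = solve (A ∷ j ∷ n ∷ y ∷ x ∷ z ∷ [])

    module Far (n g h : ℕ) (u≡ : u ≡ suc n * K + g) (g<K : g < K)
               (hA≤g : h * A ≤ g) (g<hA+A : g < suc h * A) where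

      nK≤u : suc n * K ≤ u
      nK≤u = subst (suc n * K ≤_) (sym u≡) (m≤m+n _ g)

      1≤nK : 1 ≤ suc n * K
      1≤nK = ≤-trans 1≤K (m≤m+n K _)

      y₃≤ : y₃ ≤ suc n * (K + j * A) + suc n * (2 * A) + g + h * A
      y₃≤ = linear 0
        -- The unit by which u + 1 exceeds u goes to the remainder: `suc g` still fits into `K` and
        -- into h + 1 parts of length `A`.
        (y₃-bound 1≤nK (s≤s z≤n) (trans (+-suc (suc n * K) g) (cong suc (sym u≡)))
          ⊕ X-chunks n nK≤u ⊕ X-layer h (suc g) (s≤s z≤n) (≤-trans g<K K≤s) g<hA+A)
        (ident A j n g h y₃ (X (suc n * K)) (X (suc g)))
        where
        ident : ∀ A j n g h y x z →
          y + (2 * A + (x + z) + (suc n * (suc j * A + j * A) + n * (2 * A)) + (suc g + h * A)) + 0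
            ≡ suc n * (suc j * A + j * A) + suc n * (2 * A) + g + h * A + (suc y + x + z)
        ident A j n g h y x z = solve (A ∷ j ∷ n ∷ g ∷ h ∷ y ∷ x ∷ z ∷ [])

      X-u : X u ≤ suc n * (K + j * A) + suc n * (2 * A) + g + h * A
      X-u with 1 ≤? g
      ... | no g≱1 = ≤-trans (≤-reflexive (cong X (trans u≡ (trans (cong (λ m → suc n * K + m) g≡0) (+-identityʳ _)))))
                       (linear (2 * A + g + h * A) (X-chunks n nK≤u) (ident A j n g h (X (suc n * K))))
        where
        g≡0 : g ≡ 0
        g≡0 = n<1⇒n≡0 (≰⇒> g≱1)
        ident : ∀ A j n g h x →
          x + (suc n * (suc j * A + j * A) + n * (2 * A)) + (2 * A + g + h * A)
            ≡ suc n * (suc j * A + j * A) + suc n * (2 * A) + g + h * A + x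
        ident A j n g h x = solve (A ∷ j ∷ n ∷ g ∷ h ∷ x ∷ [])
      ... | yes 1≤g = linear 0
        (≤-reflexive (cong X u≡) ⊕ join₂ 1≤nK 1≤g (≤-reflexive (sym u≡))
          ⊕ X-chunks n nK≤u ⊕ X-layer h g 1≤g (≤-trans (<⇒≤ g<K) K≤s) (<⇒≤ g<hA+A))
        (ident A j n g h (X u) (X (suc n * K + g)) (X (suc n * K)) (X g))
        where
        ident : ∀ A j n g h y w x z →
          y + (w + (2 * A + (x + z)) + (suc n * (suc j * A + j * A) + n * (2 * A)) + (g + h * A)) + 0
            ≡ suc n * (suc j * A + j * A) + suc n * (2 * A) + g + h * A + (y + w + x + z)
        ident A j n g h y w x z = solve (A ∷ j ∷ n ∷ g ∷ h ∷ y ∷ w ∷ x ∷ z ∷ [])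

-- The quadratic inequality for c = 4, 5, 6

-- The last two hypotheses are 13 n < 2 (X n + B) at n = i K and at n = i K + g = u.
far-absurd : ∀ A j n s g h → let K = suc j * A ; i = 2 + n in
  1 ≤ A → s < suc (suc j) * A → g < K → h * A ≤ g → s + K ≤ i * K + g →
  suc (5 * (i * K) + 4 * A) ≤ 4 * (i * A) + 2 * s + 2 * K + 2 * g + 2 * (h * A) →
  suc (5 * (i * K) + 9 * g) ≤ 4 * (i * A) + 4 * (h * A) + 2 * s + 2 * K → ⊥
-- For K ≥ 2 A the condition at u already fails.
far-absurd A (suc j) n s g h _ s< _ hA≤g _ _ at-u =
  absurd (2 + 5 * g + (2 + 6 * j + 6 * n + 5 * (n * j)) * A) (at-u ⊕ 4 ⊗ hA≤g ⊕ 2 ⊗ s<) (ident A j n s g h)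
  where
  ident : ∀ A j n s g h →
    suc (5 * ((2 + n) * (suc (suc j) * A)) + 9 * g) + 4 * (h * A) + 2 * suc s
      ≡ suc (4 * ((2 + n) * A) + 4 * (h * A) + 2 * s + 2 * (suc (suc j) * A) + 4 * g
             + 2 * (suc (suc (suc j)) * A) + (2 + 5 * g + (2 + 6 * j + 6 * n + 5 * (n * j)) * A))
  ident A j n s g h = solve (A ∷ j ∷ n ∷ s ∷ g ∷ h ∷ [])
-- From here on K = A, and g < A forces h = 0.
far-absurd A zero n s g (suc h) _ _ g< hA≤g _ _ _ = absurd (h * A) (g< ⊕ hA≤g) (ident A g h)
  where
  ident : ∀ A g h → suc g + suc h * A ≡ suc (1 * A + g + h * A)
  ident A g h = solve (A ∷ g ∷ h ∷ [])
far-absurd A zero zero s g zero _ _ _ _ s≤ at-iK at-u = absurd (1 + 3 * g) (at-iK ⊕ at-u ⊕ 4 ⊗ s≤) (ident A s g)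
  where
  ident : ∀ A s g →
    suc (5 * (2 * (1 * A)) + 4 * A) + suc (5 * (2 * (1 * A)) + 9 * g) + 4 * (s + 1 * A)
      ≡ suc (4 * (2 * A) + 2 * s + 2 * (1 * A) + 2 * g + 2 * 0 + (4 * (2 * A) + 4 * 0 + 2 * s + 2 * (1 * A))
             + 4 * (2 * (1 * A) + g) + (1 + 3 * g))
  ident A s g = solve (A ∷ s ∷ g ∷ [])
-- The weights 9 and 2 cancel g and leave 47 A < 22 s, against s < 2 A.
far-absurd A zero (suc zero) s g zero _ s< _ _ _ at-iK at-u =
  absurd (32 + 3 * A) (9 ⊗ at-iK ⊕ 2 ⊗ at-u ⊕ 22 ⊗ s<) (ident A s g)
  where
  ident : ∀ A s g →
    9 * suc (5 * (3 * (1 * A)) + 4 * A) + 2 * suc (5 * (3 * (1 * A)) + 9 * g) + 22 * suc s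
      ≡ suc (9 * (4 * (3 * A) + 2 * s + 2 * (1 * A) + 2 * g + 2 * 0) + 2 * (4 * (3 * A) + 4 * 0 + 2 * s + 2 * (1 * A))
             + 22 * (2 * A) + (32 + 3 * A))
  ident A s g = solve (A ∷ s ∷ g ∷ [])
far-absurd A zero (suc (suc n)) s g zero _ s< g< _ _ at-iK _ =
  absurd (4 + n * A) (at-iK ⊕ 2 ⊗ s< ⊕ 2 ⊗ g<) (ident A n s g)
  where
  ident : ∀ A n s g →
    suc (5 * ((4 + n) * (1 * A)) + 4 * A) + 2 * suc s + 2 * suc g
      ≡ suc (4 * ((4 + n) * A) + 2 * s + 2 * (1 * A) + 2 * g + 2 * 0 + 2 * (2 * A) + 2 * (1 * A) + (4 + n * A))
  ident A n s g = solve (A ∷ n ∷ s ∷ g ∷ [])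

-- This is q n ≤ X n + B for q = 3 + F / D, cleared of denominators. The claimed suprema exceed 3,
-- so only q ≥ 3 matters and `F` can be a natural number.
RatioBound : (ℕ → ℕ) → ℕ → ℕ → ℕ → ℕ → Set
RatioBound X u B D F = ∀ n → 1 ≤ n → n ≤ u → (3 * D + F) * n ≤ D * (X n + B)

-- (q - 3)² + 2 (q - 3) ≤ r (q - 3) + 3 r for q = 3 + F / D, where c = r + 3.
Quadratic : ℕ → ℕ → ℕ → Set
Quadratic r D F = F * F + 2 * (D * F) ≤ r * (D * F) + 3 * r * (D * D)

positive-multiple : ∀ {A n} → 1 ≤ A → A ≤ n → ∃[ j ] suc j * A ≤ n × n < suc (suc j) * A
positive-multiple {A} {n} 1≤A A≤n with division n 1≤A
... | zero , _ , n<A = ⊥-elim (<⇒≱ n<A (subst (_≤ n) (sym (*-identityˡ A)) A≤n))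
... | suc j , lower , upper = j , lower , upper

beyond : ∀ {A K n} → 1 ≤ A → K ≤ n → ∃[ e ] K + e * A ≤ n × n < K + suc e * A
beyond {A} {K} {n} 1≤A K≤n with division (n ∸ K) 1≤A
... | e , lower , upper = e ,
  subst (K + e * A ≤_) (m+[n∸m]≡n K≤n) (+-monoʳ-≤ K lower) ,
  subst (_< K + suc e * A) (m+[n∸m]≡n K≤n) (+-monoʳ-< K upper)

remainder : ∀ {A} n → 1 ≤ A → ∃[ i ] ∃[ g ] n ≡ i * A + g × g < A
remainder {A} n 1≤A with division n 1≤A
... | i , lower , upper = i , n ∸ i * A , sym (m+[n∸m]≡n lower) ,
  +-cancelˡ-< (i * A) _ _ (subst₂ _<_ (sym (m+[n∸m]≡n lower)) (+-comm A (i * A)) upper)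

module _ {X A s u y₂ y₃} (profile : Profile X A s u y₂ y₃) (B D F : ℕ)
         (ratio : RatioBound X u B D F) where
  open Profile profile
  open Bounds profile

  -- v * D < w * F says q > 3 + v / w.
  gap : ∀ v w → v * D < w * F → ∀ n → 1 ≤ n → n ≤ u → (3 * w + v) * n < w * (X n + B)
  gap v w v<w n@(suc m) 1≤n n≤u = *-cancelˡ-< D _ _
    (linear m (n ⊗ v<w ⊕ w ⊗ ratio n 1≤n n≤u) (ident m v w D F (X n) B))
    where
    ident : ∀ m v w D F x B →
      suc (D * ((3 * w + v) * suc m)) + (suc m * (w * F) + w * (D * (x + B))) + m
        ≡ D * (w * (x + B)) + (suc m * suc (v * D) + w * ((3 * D + F) * suc m))
    ident m v w D F x B = solve (m ∷ v ∷ w ∷ D ∷ F ∷ x ∷ B ∷ [])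

  -- With f = F / D the ratios at K and s give f K ≤ s and (1 + f) s ≤ 2 K + A ≤ 3 K. Hence f² K ≤ f
  -- s ≤ 3 K - s ≤ 3 K - f K.
  quadratic₄ : B ≤ A + y₂ → Quadratic 1 D F
  quadratic₄ B≤ with positive-multiple 1≤A A≤s
  ... | j , K≤s , s< = *-cancelʳ-≤ _ _ (suc j * A) {{>-nonZero (1≤K j K≤s s<)}}
    (linear 0 (F ⊗ at-K ⊕ D ⊗ at-s ⊕ D ⊗ D ⊗ A≤K ⊕ D ⊗ at-K) (ident₃ A j s D F))
    where
    A≤K : A ≤ suc j * A
    A≤K = m≤m+n A _
    B≤′ : B ≤ A + (s + suc j * A)
    B≤′ = ≤-trans B≤ (+-monoʳ-≤ A (y₂≤ j K≤s s<))
    at-K : F * (suc j * A) ≤ D * s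
    at-K = linear 0 (ratio _ (1≤K j K≤s s<) (≤-trans K≤s s≤u) ⊕ D ⊗ (X-K j K≤s s< ⊕ B≤′))
      (ident A j s D F (X (suc j * A)) B)
      where
      ident : ∀ A j s D F x B →
        F * (suc j * A) + (D * (x + B) + D * (suc j * A + j * A + (A + (s + suc j * A)))) + 0
          ≡ D * s + ((3 * D + F) * (suc j * A) + D * (x + B))
      ident A j s D F x B = solve (A ∷ j ∷ s ∷ D ∷ F ∷ x ∷ B ∷ [])
    at-s : (D + F) * s ≤ D * (2 * (suc j * A) + A)
    at-s = linear 0 (ratio _ 1≤s s≤u ⊕ D ⊗ (X-s j K≤s s< ⊕ B≤′)) (ident A j s D F (X s) B)
      where
      ident : ∀ A j s D F x B →
        (D + F) * s + (D * (x + B) + D * (s + suc j * A + (A + (s + suc j * A)))) + 0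
          ≡ D * (2 * (suc j * A) + A) + ((3 * D + F) * s + D * (x + B))
      ident A j s D F x B = solve (A ∷ j ∷ s ∷ D ∷ F ∷ x ∷ B ∷ [])
    ident₃ : ∀ A j s D F →
      (F * F + 2 * (D * F)) * (suc j * A) + (F * (D * s) + D * (D * (2 * (suc j * A) + A)) + D * (D * (suc j * A)) + D * (D * s)) + 0
        ≡ (1 * (D * F) + 3 * 1 * (D * D)) * (suc j * A)
          + (F * (F * (suc j * A)) + D * ((D + F) * s) + D * (D * A) + D * (F * (suc j * A)))
    ident₃ A j s D F = solve (A ∷ j ∷ s ∷ D ∷ F ∷ [])

  -- If q > 5, then s < 2 A.
  quadratic₅ : B ≤ A + y₃ → B ≤ y₂ + y₂ → Quadratic 2 D F
  quadratic₅ B≤Ay₃ B≤y₂y₂ with 2 * D <? 1 * F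
  -- 6 D² - F² = (2 D - F) (2 D + F) + 2 D².
  ... | no q≤5 = linear (2 * (D * D)) (F ⊗ ≮⇒≥ q≤5 ⊕ 2 ⊗ D ⊗ ≮⇒≥ q≤5) (ident D F)
    where
    ident : ∀ D F →
      F * F + 2 * (D * F) + (F * (2 * D) + 2 * (D * (2 * D))) + 2 * (D * D)
        ≡ 2 * (D * F) + 3 * 2 * (D * D) + (F * (1 * F) + 2 * (D * (1 * F)))
    ident D F = solve (D ∷ F ∷ [])
  ... | yes q>5 with positive-multiple 1≤A A≤s
  -- With K = A the two ratios become f A ≤ 2 s and f s ≤ 3 A, so f² ≤ 6.
  ...   | zero , K≤s , s< = *-cancelʳ-≤ _ _ A {{>-nonZero 1≤A}} (linear 0 (F ⊗ at-A ⊕ (2 * D) ⊗ at-s) (ident₃ A s D F))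
    where
    B≤ : B ≤ s + 1 * A + (s + 1 * A)
    B≤ = ≤-trans B≤y₂y₂ (y₂≤ 0 K≤s s< ⊕ y₂≤ 0 K≤s s<)
    at-A : F * A ≤ 2 * D * s
    at-A = linear 0 (ratio A 1≤A A≤u ⊕ D ⊗ (X-base A 1≤A ≤-refl ⊕ B≤)) (ident A s D F (X A) B)
      where
      ident : ∀ A s D F x B →
        F * A + (D * (x + B) + D * (A + (s + 1 * A + (s + 1 * A)))) + 0
          ≡ 2 * D * s + ((3 * D + F) * A + D * (x + B))
      ident A s D F x B = solve (A ∷ s ∷ D ∷ F ∷ x ∷ B ∷ [])
    at-s : F * s ≤ 3 * D * A
    at-s = linear 0 (ratio s 1≤s s≤u ⊕ D ⊗ (X-s 0 K≤s s< ⊕ B≤)) (ident A s D F (X s) B)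
      where
      ident : ∀ A s D F x B →
        F * s + (D * (x + B) + D * (s + 1 * A + (s + 1 * A + (s + 1 * A)))) + 0
          ≡ 3 * D * A + ((3 * D + F) * s + D * (x + B))
      ident A s D F x B = solve (A ∷ s ∷ D ∷ F ∷ x ∷ B ∷ [])
    ident₃ : ∀ A s D F →
      (F * F + 2 * (D * F)) * A + (F * (2 * D * s) + 2 * D * (3 * D * A)) + 0
        ≡ (2 * (D * F) + 3 * 2 * (D * D)) * A + (F * (F * A) + 2 * D * (F * s))
    ident₃ A s D F = solve (A ∷ s ∷ D ∷ F ∷ [])
  ...   | suc j , K≤s , s< with u <? s + suc (suc j) * A
  -- The ratio at s + K would give 2 s < A.
  ...     | no u≮ = ⊥-elim (absurd A
      (gap 2 1 q>5 (s + k * A) (≤-trans 1≤s (m≤m+n s _)) (≮⇒≥ u≮)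
        ⊕ join₂ 1≤s (1≤K (suc j) K≤s s<) (≮⇒≥ u≮) ⊕ X-s (suc j) K≤s s< ⊕ X-K (suc j) K≤s s<
        ⊕ B≤y₂y₂ ⊕ 2 ⊗ y₂≤ (suc j) K≤s s< ⊕ 2 ⊗ A≤s)
      (ident A j s (X (s + k * A)) (X s) (X (k * A)) B y₂))
    where
    k : ℕ
    k = suc (suc j)
    ident : ∀ A j s w x z B y →
      suc (5 * (s + suc (suc j) * A)) + w + x + z + B + 2 * y + 2 * A
        ≡ suc (1 * (w + B) + (2 * A + (x + z)) + (s + suc (suc j) * A) + (suc (suc j) * A + suc j * A)
               + (y + y) + 2 * (s + suc (suc j) * A) + 2 * s + A)
    ident A j s w x z B y = solve (A ∷ j ∷ s ∷ w ∷ x ∷ z ∷ B ∷ y ∷ [])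
  ...     | yes u<s+K with beyond 1≤A (≤-trans K≤s s≤u)
  -- The ratio at K would give 2 K < u + A < K + 2 A, although K ≥ 2 A.
  ...       | zero , lower , upper = ⊥-elim (absurd (1 + j * A)
      (gap 2 1 q>5 (k * A) (1≤K (suc j) K≤s s<) (≤-trans K≤s s≤u)
        ⊕ X-K (suc j) K≤s s< ⊕ B≤Ay₃ ⊕ y₃≤ ⊕ upper)
      (ident A j u (X (k * A)) B y₃))
    where
    open Near (suc j) K≤s s< 0 u<s+K upper
    k : ℕ
    k = suc (suc j)
    ident : ∀ A j u x B y →
      suc (5 * (suc (suc j) * A)) + x + B + y + suc u
        ≡ suc (1 * (x + B) + (suc (suc j) * A + suc j * A) + (A + y) + (u + (2 + suc j + 0) * A)
               + (suc (suc j) * A + 1 * A) + (1 + j * A))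
    ident A j u x B y = solve (A ∷ j ∷ u ∷ x ∷ B ∷ y ∷ [])
  -- The ratio at u would give 3 u < (2 j + 2 e + 9) A, although u ≥ (j + e + 3) A.
  ...       | suc e , lower , upper = ⊥-elim (absurd ((j + e) * A)
      (gap 2 1 q>5 u (≤-trans 1≤A A≤u) ≤-refl ⊕ X-u ⊕ B≤Ay₃ ⊕ y₃≤ ⊕ 3 ⊗ lower)
      (ident A j e u (X u) B y₃))
    where
    open Near (suc j) K≤s s< (suc e) u<s+K upper
    ident : ∀ A j e u x B y →
      suc (5 * u) + x + B + y + 3 * (suc (suc j) * A + suc e * A)
        ≡ suc (1 * (x + B) + (u + (2 + suc j + suc e) * A) + (A + y) + (u + (2 + suc j + suc e) * A)
               + 3 * u + (j + e) * A)
    ident A j e u x B y = solve (A ∷ j ∷ e ∷ u ∷ x ∷ B ∷ y ∷ [])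

  -- If q > 13/2, then ⌊u / A⌋ = ⌊s / A⌋.
  quadratic₆ : B ≤ y₂ + y₃ → Quadratic 3 D F
  quadratic₆ B≤ with 7 * D <? 2 * F
  -- The threshold 13/2 lies just below δ(6), and 4 (9 D² + D F - F²) = (7 D - 2 F) (5 D + 2 F) +
  -- D².
  ... | no q≤13/2 = *-cancelˡ-≤ 4 (linear (D * D) (2 ⊗ F ⊗ ≮⇒≥ q≤13/2 ⊕ 5 ⊗ D ⊗ ≮⇒≥ q≤13/2) (ident D F))
    where
    ident : ∀ D F →
      4 * (F * F + 2 * (D * F)) + (2 * (F * (7 * D)) + 5 * (D * (7 * D))) + D * D
        ≡ 4 * (3 * (D * F) + 3 * 3 * (D * D)) + (2 * (F * (2 * F)) + 5 * (D * (2 * F)))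
    ident D F = solve (D ∷ F ∷ [])
  ... | yes q>13/2 with positive-multiple 1≤A A≤s
  ...   | j , K≤s , s< with u <? s + suc j * A
  ...     | no u≮ = ⊥-elim far
    where
    K′ : ℕ
    K′ = suc j * A
    far : ⊥
    far with remainder u (1≤K j K≤s s<)
    ... | zero , g , u≡ , g<K = <⇒≱ g<K (≤-trans (≤-trans K≤s s≤u) (≤-reflexive u≡))
    ... | suc zero , g , u≡ , g<K = <⇒≱ g<K (+-cancelˡ-≤ (1 * K′) K′ g
      (subst₂ _≤_ (cong (_+ K′) (sym (*-identityˡ K′))) u≡ (≤-trans (+-monoˡ-≤ K′ K≤s) (≮⇒≥ u≮))))
    ... | suc (suc n) , g , u≡ , g<K with division g 1≤A
    ...   | h , lower , upper = far-absurd A j n s g h 1≤A s< g<K lower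
      (≤-trans (≮⇒≥ u≮) (≤-reflexive u≡))
      (linear 0 (gap 7 2 q>13/2 (suc (suc n) * K′) 1≤nK nK≤u ⊕ 2 ⊗ X-chunks j K≤s s< (suc n) nK≤u ⊕ 2 ⊗ B≤′)
        (ident₁ A j n s g h (X (suc (suc n) * K′)) B y₂ y₃))
      (linear 0 (gap 7 2 q>13/2 u (≤-trans 1≤A A≤u) ≤-refl ⊕ 2 ⊗ X-u ⊕ 2 ⊗ B≤′ ⊕ 13 ⊗ ≤-reflexive (sym u≡))
        (ident₂ A j n s g h u (X u) B y₂ y₃))
      where
      open Far j K≤s s< (suc n) g h u≡ g<K lower upper
      B≤′ = ≤-trans B≤ (y₂≤ j K≤s s< ⊕ y₃≤)
      ident₁ : ∀ A j n s g h x B y z → let K = suc j * A ; i = 2 + n in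
        suc (5 * (i * K) + 4 * A)
          + (2 * (x + B) + 2 * (i * (K + j * A) + suc n * (2 * A)) + 2 * (s + K + (i * (K + j * A) + i * (2 * A) + g + h * A))) + 0
        ≡ 4 * (i * A) + 2 * s + 2 * K + 2 * g + 2 * (h * A) + (suc (13 * (i * K)) + 2 * x + 2 * B)
      ident₁ A j n s g h x B y z = solve (A ∷ j ∷ n ∷ s ∷ g ∷ h ∷ x ∷ B ∷ y ∷ z ∷ [])
      ident₂ : ∀ A j n s g h u x B y z → let K = suc j * A ; i = 2 + n in
        suc (5 * (i * K) + 9 * g)
          + (2 * (x + B) + 2 * (i * (K + j * A) + i * (2 * A) + g + h * A)
             + 2 * (s + K + (i * (K + j * A) + i * (2 * A) + g + h * A)) + 13 * u) + 0
        ≡ 4 * (i * A) + 4 * (h * A) + 2 * s + 2 * K + (suc (13 * u) + 2 * x + 2 * B + 13 * (i * K + g))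
      ident₂ A j n s g h u x B y z = solve (A ∷ j ∷ n ∷ s ∷ g ∷ h ∷ u ∷ x ∷ B ∷ y ∷ z ∷ [])
  ...     | yes u<s+K with beyond 1≤A (≤-trans K≤s s≤u)
  -- With l = ⌊u / A⌋ = j + e + 2, the ratio at l A, where `X-multiple` applies, would give 5 l < 4
  -- j + 10.
  ...       | suc e , lower , upper = ⊥-elim (absurd (4 + (j + 5 * e) * A)
      (gap 7 2 q>13/2 (suc j * A + suc e * A) (≤-trans (1≤K j K≤s s<) (m≤m+n _ _)) lower
        ⊕ 2 ⊗ X-multiple e refl lower ⊕ 2 ⊗ B≤ ⊕ 2 ⊗ y₂≤ j K≤s s< ⊕ 2 ⊗ y₃≤ ⊕ 2 ⊗ s< ⊕ 2 ⊗ upper)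
      (ident A j e s u (X (suc j * A + suc e * A)) B y₂ y₃))
    where
    open Near j K≤s s< (suc e) u<s+K upper
    ident : ∀ A j e s u x B y z →
      suc (13 * (suc j * A + suc e * A)) + 2 * x + 2 * B + 2 * y + 2 * z + 2 * suc s + 2 * suc u
        ≡ suc (2 * (x + B) + 2 * (2 * (suc j * A + suc e * A)) + 2 * (y + z) + 2 * (s + suc j * A)
               + 2 * (u + (2 + j + suc e) * A) + 2 * (suc (suc j) * A) + 2 * (suc j * A + suc (suc e) * A)
               + (4 + (j + 5 * e) * A))
    ident A j e s u x B y z = solve (A ∷ j ∷ e ∷ s ∷ u ∷ x ∷ B ∷ y ∷ z ∷ [])
  -- The bound on `B` depends on s and u only through s + u, so the ratios at s and u are added: f
  -- (s + u) ≤ 6 K + 3 A. With f K ≤ K + s + u this yields f² K ≤ f K + 9 K.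
  ...       | zero , lower , upper = *-cancelʳ-≤ _ _ (suc j * A) {{>-nonZero (1≤K j K≤s s<)}}
    (linear 0 (F ⊗ at-K ⊕ D ⊗ at-su ⊕ D ⊗ D ⊗ 3 ⊗ A≤K) (ident₄ A j s u D F))
    where
    open Near j K≤s s< 0 u<s+K upper
    A≤K : A ≤ suc j * A
    A≤K = m≤m+n A _
    B≤′ : B ≤ s + suc j * A + (u + (2 + j + 0) * A)
    B≤′ = ≤-trans B≤ (y₂≤ j K≤s s< ⊕ y₃≤)
    at-K : F * (suc j * A) ≤ D * (suc j * A + (s + u))
    at-K = linear 0 (ratio _ (1≤K j K≤s s<) (≤-trans K≤s s≤u) ⊕ D ⊗ (X-K j K≤s s< ⊕ B≤′))
      (ident A j s u D F (X (suc j * A)) B)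
      where
      ident : ∀ A j s u D F x B →
        F * (suc j * A) + (D * (x + B) + D * (suc j * A + j * A + (s + suc j * A + (u + (2 + j + 0) * A)))) + 0
          ≡ D * (suc j * A + (s + u)) + ((3 * D + F) * (suc j * A) + D * (x + B))
      ident A j s u D F x B = solve (A ∷ j ∷ s ∷ u ∷ D ∷ F ∷ x ∷ B ∷ [])
    at-su : F * (s + u) ≤ D * (6 * (suc j * A) + 3 * A)
    at-su = linear 0 (ratio s 1≤s s≤u ⊕ ratio u (≤-trans 1≤A A≤u) ≤-refl ⊕ D ⊗ (X-s j K≤s s< ⊕ X-u ⊕ 2 ⊗ B≤′))
      (ident A j s u D F (X s) (X u) B)
      where
      ident : ∀ A j s u D F x z B →
        F * (s + u) + (D * (x + B) + D * (z + B)
           + D * (s + suc j * A + (u + (2 + j + 0) * A) + 2 * (s + suc j * A + (u + (2 + j + 0) * A)))) + 0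
          ≡ D * (6 * (suc j * A) + 3 * A) + ((3 * D + F) * s + (3 * D + F) * u + D * (x + z + 2 * B))
      ident A j s u D F x z B = solve (A ∷ j ∷ s ∷ u ∷ D ∷ F ∷ x ∷ z ∷ B ∷ [])
    ident₄ : ∀ A j s u D F →
      (F * F + 2 * (D * F)) * (suc j * A) + (F * (D * (suc j * A + (s + u))) + D * (D * (6 * (suc j * A) + 3 * A)) + D * (D * (3 * (suc j * A)))) + 0
        ≡ (3 * (D * F) + 3 * 3 * (D * D)) * (suc j * A)
          + (F * (F * (suc j * A)) + D * (F * (s + u)) + D * (D * (3 * A)))
    ident₄ A j s u D F = solve (A ∷ j ∷ s ∷ u ∷ D ∷ F ∷ [])

-- The recursion on lists

nth : List ℕ → ℕ → ℕ
nth [] _ = 0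
nth (x ∷ xs) zero = x
nth (x ∷ xs) (suc i) = nth xs i

nth-++ˡ : ∀ xs ys i → i < length xs → nth (xs ++ ys) i ≡ nth xs i
nth-++ˡ (x ∷ xs) ys zero _ = refl
nth-++ˡ (x ∷ xs) ys (suc i) (s≤s i<) = nth-++ˡ xs ys i i<

nth-++-length : ∀ xs y ys → nth (xs ++ y ∷ ys) (length xs) ≡ y
nth-++-length [] y ys = refl
nth-++-length (x ∷ xs) y ys = nth-++-length xs y ys

take-++-length : ∀ (xs ys : List ℕ) → take (length xs) (xs ++ ys) ≡ xs
take-++-length [] ys = refl
take-++-length (x ∷ xs) ys = cong (x ∷_) (take-++-length xs ys)

nth-take : ∀ n xs i → i < n → nth (take n xs) i ≡ nth xs i
nth-take (suc n) [] i _ = refl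
nth-take (suc n) (x ∷ xs) zero _ = refl
nth-take (suc n) (x ∷ xs) (suc i) (s≤s i<n) = nth-take n xs i i<n

nth-reverse : ∀ xs i j → i + suc j ≡ length xs → nth (reverse xs) i ≡ nth xs j
nth-reverse [] i j eq with () ← trans (sym (+-suc i j)) eq
nth-reverse (x ∷ xs) i zero eq = begin
  nth (reverse (x ∷ xs)) i                     ≡⟨ cong (λ zs → nth zs i) (unfold-reverse x xs) ⟩
  nth (reverse xs ++ [ x ]) i                  ≡⟨ cong (nth (reverse xs ++ [ x ])) i≡ ⟩
  nth (reverse xs ++ [ x ]) (length (reverse xs)) ≡⟨ nth-++-length (reverse xs) x [] ⟩
  x                                            ∎
  where
  open ≡-Reasoning
  i≡ : i ≡ length (reverse xs)
  i≡ = trans (suc-injective (trans (+-comm 1 i) eq)) (sym (length-reverse xs))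
nth-reverse (x ∷ xs) i (suc j) eq = begin
  nth (reverse (x ∷ xs)) i     ≡⟨ cong (λ zs → nth zs i) (unfold-reverse x xs) ⟩
  nth (reverse xs ++ [ x ]) i  ≡⟨ nth-++ˡ (reverse xs) [ x ] i i< ⟩
  nth (reverse xs) i           ≡⟨ nth-reverse xs i j eq′ ⟩
  nth xs j                     ∎
  where
  open ≡-Reasoning
  eq′ : i + suc j ≡ length xs
  eq′ = suc-injective (trans (sym (+-suc i (suc j))) eq)
  i< : i < length (reverse xs)
  i< = subst (i <_) (trans eq′ (sym (length-reverse xs))) (m<m+n i (s≤s z≤n))

nth-zipWith : ∀ xs ys i → i < length xs → i < length ys → nth (zipWith _+_ xs ys) i ≡ nth xs i + nth ys i
nth-zipWith (x ∷ xs) (y ∷ ys) zero _ _ = refl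
nth-zipWith (x ∷ xs) (y ∷ ys) (suc i) (s≤s i<) (s≤s i<′) = nth-zipWith xs ys i i< i<′

minList-lower : ∀ xs i → i < length xs → minList xs ≤ nth xs i
minList-lower (x ∷ []) zero _ = ≤-refl
minList-lower (x ∷ []) (suc i) (s≤s ())
minList-lower (x ∷ y ∷ ys) zero _ = m⊓n≤m x _
minList-lower (x ∷ y ∷ ys) (suc i) (s≤s i<) = ≤-trans (m⊓n≤n x _) (minList-lower (y ∷ ys) i i<)

minList-greatest : ∀ {v} xs → 0 < length xs → (∀ i → i < length xs → v ≤ nth xs i) → v ≤ minList xs
minList-greatest (x ∷ []) _ h = h 0 (s≤s z≤n)
minList-greatest (x ∷ y ∷ ys) _ h =
  ⊓-glb (h 0 (s≤s z≤n)) (minList-greatest (y ∷ ys) (s≤s z≤n) (λ i i< → h (suc i) (s≤s i<)))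

pairSums : List ℕ → List ℕ
pairSums xs = zipWith _+_ xs (reverse xs)

private
  length-pairs : ∀ xs → length (pairSums xs) ≡ length xs
  length-pairs xs = begin
    length (pairSums xs)  ≡⟨ length-zipWith _+_ xs (reverse xs) ⟩
    length xs ⊓ length (reverse xs)       ≡⟨ cong (length xs ⊓_) (length-reverse xs) ⟩
    length xs ⊓ length xs                 ≡⟨ ⊓-idem (length xs) ⟩
    length xs                             ∎
    where open ≡-Reasoning

  nth-pairs : ∀ xs i j → i + suc j ≡ length xs → nth (pairSums xs) i ≡ nth xs i + nth xs j
  nth-pairs xs i j eq = trans (nth-zipWith xs (reverse xs) i i< (subst (i <_) (sym (length-reverse xs)) i<))
                              (cong (λ m → nth xs i + m) (nth-reverse xs i j eq))
    where
    i< : i < length xs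
    i< = subst (i <_) eq (m<m+n i (s≤s z≤n))

-- The equation `i + suc j ≡ length xs` expresses j1 + j2 = n - 1 without truncated subtraction.
minPair-lower : ∀ xs i j → i + suc j ≡ length xs → minPair xs ≤ nth xs i + nth xs j
minPair-lower xs i j eq = ≤-trans
  (minList-lower (pairSums xs) i (subst (i <_) (trans eq (sym (length-pairs xs))) (m<m+n i (s≤s z≤n))))
  (≤-reflexive (nth-pairs xs i j eq))

minPair-greatest : ∀ {v} xs → 0 < length xs →
  (∀ i j → i + suc j ≡ length xs → v ≤ nth xs i + nth xs j) → v ≤ minPair xs
minPair-greatest {v} xs 0< h = minList-greatest (pairSums xs) (subst (0 <_) (sym (length-pairs xs)) 0<) bound
  where
  bound : ∀ i → i < length (pairSums xs) → v ≤ nth (pairSums xs) i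
  bound i i< = ≤-trans (h i j eq) (≤-reflexive (sym (nth-pairs xs i j eq)))
    where
    i<′ : i < length xs
    i<′ = subst (i <_) (length-pairs xs) i<
    j : ℕ
    j = length xs ∸ suc i
    eq : i + suc j ≡ length xs
    eq = trans (+-suc i j) (m+[n∸m]≡n i<′)

-- The recursion as equations on the final lists

minPairOf : List ℕ → ℕ → ℕ
minPairOf xs n = minPair (take n xs)

module _ (xs : List ℕ) {n : ℕ} (n≤ : n ≤ length xs) where
  private
    length-prefix : length (take n xs) ≡ n
    length-prefix = trans (length-take n xs) (m≤n⇒m⊓n≡m n≤)

    nth-prefix : ∀ i j → i + suc j ≡ n → nth (take n xs) i + nth (take n xs) j ≡ nth xs i + nth xs j
    nth-prefix i j eq = cong₂ _+_ (nth-take n xs i (subst (i <_) eq (m<m+n i (s≤s z≤n))))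
                                  (nth-take n xs j (subst (j <_) eq (m≤n+m (suc j) i)))

  minPairOf-lower : ∀ i j → i + suc j ≡ n → minPairOf xs n ≤ nth xs i + nth xs j
  minPairOf-lower i j eq = ≤-trans (minPair-lower (take n xs) i j (trans eq (sym length-prefix)))
                                   (≤-reflexive (nth-prefix i j eq))

  minPairOf-greatest : ∀ {v} → 0 < n → (∀ i j → i + suc j ≡ n → v ≤ nth xs i + nth xs j) → v ≤ minPairOf xs n
  minPairOf-greatest 0<n h = minPair-greatest (take n xs) (subst (0 <_) (sym length-prefix) 0<n)
    (λ i j eq → ≤-trans (h i j (trans eq length-prefix)) (≤-reflexive (sym (nth-prefix i j (trans eq length-prefix)))))

-- Here `xs` and `ys` are the final lists, `n` and `m` the current lengths, and the word consists of
-- the letters still to come. Entries are only appended, so every earlier state is a pair of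
-- prefixes and the recursion becomes a set of equations about two fixed lists.
Trajectory : List ℕ → List ℕ → ℕ → ℕ → List Letter → Set
Trajectory xs ys n m [] = n ≡ length xs × m ≡ length ys
Trajectory xs ys n m (l1 ∷ α) = nth xs n ≡ suc (minPairOf xs n + minPairOf ys m) × Trajectory xs ys (suc n) m α
Trajectory xs ys n m (l2 ∷ α) = nth ys m ≡ suc (minPairOf xs n + minPairOf ys m) × Trajectory xs ys n (suc m) α

run-extends : ∀ a b α → (∃[ zs ] xs1 (run (st a b) α) ≡ a ++ zs) × (∃[ zs ] xs2 (run (st a b) α) ≡ b ++ zs)
run-extends a b [] = ([] , sym (++-identityʳ a)) , ([] , sym (++-identityʳ b))
run-extends a b (l1 ∷ α) with run-extends (a ++ [ kOf (st a b) ]) b α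
... | (zs , eq) , h = (_ , trans eq (++-assoc a _ zs)) , h
run-extends a b (l2 ∷ α) with run-extends a (b ++ [ kOf (st a b) ]) α
... | h , (zs , eq) = h , (_ , trans eq (++-assoc b _ zs))

nth-extension : ∀ a {xs k} → ∃[ zs ] xs ≡ (a ++ [ k ]) ++ zs → nth xs (length a) ≡ k
nth-extension a {k = k} (zs , refl) =
  trans (cong (λ ws → nth ws (length a)) (++-assoc a [ k ] zs)) (nth-++-length a k zs)

take-extension : ∀ (a : List ℕ) {xs} → ∃[ zs ] xs ≡ a ++ zs → take (length a) xs ≡ a
take-extension a (zs , refl) = take-++-length a zs

run-trajectory : ∀ a b α → let σ = run (st a b) α in Trajectory (xs1 σ) (xs2 σ) (length a) (length b) α
run-trajectory a b [] = refl , refl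
run-trajectory a b (l1 ∷ α) = trans (nth-extension a (proj₁ ext)) (sym value) ,
  subst (λ n → Trajectory xs ys n (length b) α) (trans (length-++ a) (+-comm (length a) 1))
    (run-trajectory (a ++ [ k ]) b α)
  where
  k = kOf (st a b)
  xs = xs1 (run (st (a ++ [ k ]) b) α)
  ys = xs2 (run (st (a ++ [ k ]) b) α)
  ext = run-extends (a ++ [ k ]) b α
  value : suc (minPairOf xs (length a) + minPairOf ys (length b)) ≡ k
  value = cong₂ (λ p q → suc (minPair p + minPair q)) (take-extension a (proj₁ (run-extends a b (l1 ∷ α))))
                (take-extension b (proj₂ (run-extends a b (l1 ∷ α))))
run-trajectory a b (l2 ∷ α) = trans (nth-extension b (proj₂ ext)) (sym value) ,
  subst (λ m → Trajectory xs ys (length a) m α) (trans (length-++ b) (+-comm (length b) 1))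
    (run-trajectory a (b ++ [ k ]) α)
  where
  k = kOf (st a b)
  xs = xs1 (run (st a (b ++ [ k ])) α)
  ys = xs2 (run (st a (b ++ [ k ])) α)
  ext = run-extends a (b ++ [ k ]) α
  value : suc (minPairOf xs (length a) + minPairOf ys (length b)) ≡ k
  value = cong₂ (λ p q → suc (minPair p + minPair q)) (take-extension a (proj₁ (run-extends a b (l2 ∷ α))))
                (take-extension b (proj₂ (run-extends a b (l2 ∷ α))))

module _ {xs ys : List ℕ} where

  trajectory-length : ∀ α {n m} → Trajectory xs ys n m α →
    n + count l1 α ≡ length xs × m + count l2 α ≡ length ys
  trajectory-length [] {n} {m} (n≡ , m≡) = trans (+-identityʳ n) n≡ , trans (+-identityʳ m) m≡
  trajectory-length (l1 ∷ α) {n} (_ , t) with trajectory-length α t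
  ... | n≡ , m≡ = trans (+-suc n _) n≡ , m≡
  trajectory-length (l2 ∷ α) {n} {m} (_ , t) with trajectory-length α t
  ... | n≡ , m≡ = n≡ , trans (+-suc m _) m≡

  -- Until the next letter 2 the prefix of `ys` does not change, so all new entries of `xs` share
  -- the cost `minPairOf ys m`.
  phase : ∀ k {n m α} → Trajectory xs ys n m (replicate k l1 ++ l2 ∷ α) →
    (∀ i → n ≤ i → i < k + n → nth xs i ≡ suc (minPairOf xs i + minPairOf ys m)) ×
    nth ys m ≡ suc (minPairOf xs (k + n) + minPairOf ys m) × Trajectory xs ys (k + n) (suc m) α
  phase zero (y≡ , t) = (λ i n≤i i<n → ⊥-elim (<⇒≱ i<n n≤i)) , y≡ , t
  phase (suc k) {n} {m} {α} (x≡ , t) with phase k t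
  ... | xs≡ , rest = values ,
    subst (λ l → nth ys m ≡ suc (minPairOf xs l + minPairOf ys m) × Trajectory xs ys l (suc m) α) (+-suc k n) rest
    where
    values : ∀ i → n ≤ i → i < suc k + n → nth xs i ≡ suc (minPairOf xs i + minPairOf ys m)
    values i n≤i i< with n ≟ i
    ... | yes refl = x≡
    ... | no n≢i = xs≡ i (≤∧≢⇒< n≤i n≢i) (subst (i <_) (sym (+-suc k n)) i<)

split-at-l2 : ∀ α {r} → count l2 α ≡ suc r →
  ∃[ k ] ∃[ α′ ] α ≡ replicate k l1 ++ l2 ∷ α′ × count l2 α′ ≡ r
split-at-l2 (l1 ∷ α) eq with split-at-l2 α eq
... | k , α′ , refl , eq′ = suc k , α′ , refl , eq′
split-at-l2 (l2 ∷ α) eq = 0 , α , refl , suc-injective eq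

-- The profile of a word

xsOf ysOf : List Letter → List ℕ
xsOf α = xs1 (finalState α)
ysOf α = xs2 (finalState α)

nth-extends : ∀ {xs} → ∃[ zs ] xs ≡ [ 0 ] ++ zs → nth xs 0 ≡ 0
nth-extends (zs , refl) = refl

module _ (α : List Letter) where
  final-trajectory : Trajectory (xsOf α) (ysOf α) 1 1 α
  final-trajectory = run-trajectory [ 0 ] [ 0 ] α

  nth-xs-0 : nth (xsOf α) 0 ≡ 0
  nth-xs-0 = nth-extends (proj₁ (run-extends [ 0 ] [ 0 ] α))

  nth-ys-0 : nth (ysOf α) 0 ≡ 0
  nth-ys-0 = nth-extends (proj₂ (run-extends [ 0 ] [ 0 ] α))

  -- The function X; its value at 0 is a dummy, since all bounds of a profile concern arguments that
  -- are at least 1.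
  shifted : ℕ → ℕ
  shifted zero = 0
  shifted (suc n) = suc (nth (xsOf α) n)

extract : ∀ α {r} → count l2 α ≡ 3 + r → ∃[ A ] ∃[ s ] ∃[ u ]
  nth (ysOf α) 1 ≤ A × u ≤ length (xsOf α) × Profile (shifted α) A s u (nth (ysOf α) 2) (nth (ysOf α) 3)
extract α {r} eq with split-at-l2 α eq
... | k₁ , α₁ , refl , eq₁ with split-at-l2 α₁ eq₁
...   | k₂ , α₂ , refl , eq₂ with split-at-l2 α₂ eq₂
...     | k₃ , α₃ , refl , eq₃ with phase k₁ (final-trajectory α)
...       | x₁≡ , y₁≡ , t₁ with phase k₂ t₁
...         | x₂≡ , y₂≡ , t₂ with phase k₃ t₂
...           | x₃≡ , y₃≡ , t₃ = A , s , u , y₁≤A , u≤ , record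
  { 1≤A = m≤n+m 1 k₁
  ; A≤s = m≤n+m A k₂
  ; s≤u = m≤n+m s k₃
  ; X-base = λ { (suc n) _ n≤A → s≤s (base n n≤A) }
  ; join₁ = λ { {suc i} {suc j} _ _ le → join₁ i j le }
  ; join₂ = λ { {suc i} {suc j} _ _ le → join₂ i j le }
  ; y₂-bound = λ { {suc i} {suc j} _ _ e → value-bound 2 (m≤n+m s k₃) y₂≡ P₂≤ i j (suc-injective e) }
  ; y₃-bound = λ { {suc i} {suc j} _ _ e → value-bound 3 ≤-refl y₃≡ P₃≤ i j (suc-injective e) }
  }
  where
  A = k₁ + 1
  s = k₂ + A
  u = k₃ + s
  xs = xsOf α
  ys = ysOf α

  u≤ : u ≤ length xs
  u≤ = ≤-trans (m≤m+n u _) (≤-reflexive (proj₁ (trajectory-length α₃ t₃)))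

  4≤ : 4 ≤ length ys
  4≤ = ≤-trans (m≤m+n 4 _) (≤-reflexive (proj₂ (trajectory-length α₃ t₃)))

  ≤4 : ∀ {m} → m ≤ 4 → m ≤ length ys
  ≤4 le = ≤-trans le 4≤

  -- Of the two units on the right, one is the 1 of the recursion and the other that of `suc v`.
  value-bound : ∀ m {v n M} → n ≤ u → v ≡ suc (minPairOf xs n + minPairOf ys m) → minPairOf ys m ≤ M →
    ∀ i j → i + suc j ≡ n → suc v ≤ M + (suc (nth xs i) + suc (nth xs j))
  value-bound m {v} {n} {M} n≤u v≡ P≤M i j e = linear 0
    (≤-reflexive v≡ ⊕ minPairOf-lower xs (≤-trans n≤u u≤) i j e ⊕ P≤M)
    (ident v (minPairOf xs n) (minPairOf ys m) M (nth xs i) (nth xs j))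
    where
    ident : ∀ v p q M x z → suc v + (suc (p + q) + (x + z) + M) + 0 ≡ M + (suc x + suc z) + (v + p + q)
    ident v p q M x z = solve (v ∷ p ∷ q ∷ M ∷ x ∷ z ∷ [])

  P₁≤ : minPairOf ys 1 ≤ 0
  P₁≤ = ≤-trans (minPairOf-lower ys (≤4 (s≤s z≤n)) 0 0 refl) (≤-reflexive (cong₂ _+_ (nth-ys-0 α) (nth-ys-0 α)))

  base : ∀ i → i < A → nth xs i ≤ i
  base zero _ = ≤-reflexive (nth-xs-0 α)
  -- Pairing index i with x_{1,0} = 0 shows that the value grows by at most one per index.
  base (suc i) i< = +-cancelˡ-≤ 1 _ _ (≤-trans
    (value-bound 1 (≤-trans (<⇒≤ i<) (≤-trans (m≤n+m A k₂) (m≤n+m s k₃))) (x₁≡ (suc i) (s≤s z≤n) i<) P₁≤ 0 i refl)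
    (s≤s (≤-reflexive (nth-xs-0 α)) ⊕ s≤s (base i (<-trans (n<1+n i) i<))))

  y₁≤A : nth ys 1 ≤ A
  y₁≤A = ≤-trans
    (+-cancelˡ-≤ 1 _ _ (≤-trans (value-bound 1 (≤-trans (m≤n+m A k₂) (m≤n+m s k₃)) y₁≡ P₁≤ 0 k₁ (+-comm 1 k₁))
      (s≤s (≤-reflexive (nth-xs-0 α)) ⊕ s≤s (base k₁ (m<m+n k₁ (s≤s z≤n))))))
    (≤-reflexive (+-comm 1 k₁))

  P₂≤ : minPairOf ys 2 ≤ A
  P₂≤ = ≤-trans (minPairOf-lower ys (≤4 (s≤s (s≤s z≤n))) 0 1 refl) (≤-reflexive (nth-ys-0 α) ⊕ y₁≤A)

  P₃≤ : minPairOf ys 3 ≤ 2 * A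
  P₃≤ = ≤-trans (minPairOf-lower ys (≤4 (s≤s (s≤s (s≤s z≤n)))) 1 1 refl)
    (y₁≤A ⊕ ≤-trans y₁≤A (m≤m+n A 0))

  1≤i+sj : ∀ i j → 1 ≤ i + suc j
  1≤i+sj i j = ≤-trans (s≤s z≤n) (m≤n+m (suc j) i)

  join₁ : ∀ i j → suc i + suc j ≤ s → shifted α (suc i + suc j) ≤ A + (shifted α (suc i) + shifted α (suc j))
  join₁ i j le with i + suc j <? A
  -- Before index `A` the cost is 0, so the weaker cost `A` is valid on the whole range up to `s`.
  ... | yes n<A = value-bound 1 (≤-trans (<⇒≤ le) (m≤n+m s k₃)) (x₁≡ _ (1≤i+sj i j) n<A) (≤-trans P₁≤ z≤n) i j refl
  ... | no n≮A = value-bound 2 (≤-trans (<⇒≤ le) (m≤n+m s k₃)) (x₂≡ _ (≮⇒≥ n≮A) le) P₂≤ i j refl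

  join₂ : ∀ i j → suc i + suc j ≤ u → shifted α (suc i + suc j) ≤ 2 * A + (shifted α (suc i) + shifted α (suc j))
  join₂ i j le with i + suc j <? s
  ... | yes n<s = ≤-trans (join₁ i j n<s) (+-monoˡ-≤ _ (m≤m+n A _))
  ... | no n≮s = value-bound 3 (<⇒≤ le) (x₃≡ _ (≮⇒≥ n≮s) le) P₃≤ i j refl

-- Rational arithmetic

minRatio-lower : ∀ b j xs i → i < length xs → minRatio b j xs ℚ.≤ + (nth xs i + b) ℚ./ suc (j + i)
minRatio-lower b j (x ∷ []) zero _ = ℚ.≤-reflexive (cong (λ k → + (x + b) ℚ./ suc k) (sym (+-identityʳ j)))
minRatio-lower b j (x ∷ []) (suc i) (s≤s ())
minRatio-lower b j (x ∷ y ∷ ys) zero _ = ℚ.≤-trans (ℚ.p⊓q≤p (+ (x + b) ℚ./ suc j) _)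
  (ℚ.≤-reflexive (cong (λ k → + (x + b) ℚ./ suc k) (sym (+-identityʳ j))))
minRatio-lower b j (x ∷ y ∷ ys) (suc i) (s≤s i<) = ℚ.≤-trans (ℚ.p⊓q≤q (+ (x + b) ℚ./ suc j) _)
  (subst (λ k → minRatio b (suc j) (y ∷ ys) ℚ.≤ + (nth (y ∷ ys) i + b) ℚ./ suc k) (sym (+-suc j i))
    (minRatio-lower b (suc j) (y ∷ ys) i i<))

minRatio-greatest : ∀ {v} b j xs → 0 < length xs →
  (∀ i → i < length xs → v ℚ.≤ + (nth xs i + b) ℚ./ suc (j + i)) → v ℚ.≤ minRatio b j xs
minRatio-greatest {v} b j (x ∷ []) _ h = subst (λ k → v ℚ.≤ + (x + b) ℚ./ suc k) (+-identityʳ j) (h 0 (s≤s z≤n))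
minRatio-greatest {v} b j (x ∷ y ∷ ys) _ h = ℚ.⊓-glb
  (subst (λ k → v ℚ.≤ + (x + b) ℚ./ suc k) (+-identityʳ j) (h 0 (s≤s z≤n)))
  (minRatio-greatest b (suc j) (y ∷ ys) (s≤s z≤n)
    (λ i i< → subst (λ k → v ℚ.≤ + (nth (y ∷ ys) i + b) ℚ./ suc k) (+-suc j i) (h (suc i) (s≤s i<))))

toℚᵘ-/ : ∀ n d → toℚᵘ (n ℚ./ suc d) ℚᵘ.≃ mkℚᵘ n d
toℚᵘ-/ n d = ℚ.toℚᵘ-fromℚᵘ (mkℚᵘ n d)

-- `q` is given by an unnormalised fraction up to `≃`, so that no gcd enters the cross
-- multiplication.
≤⇒cross : ∀ {q n d} m e → toℚᵘ q ℚᵘ.≃ mkℚᵘ (+ n) d → q ℚ.≤ + m ℚ./ suc e → n * suc e ≤ m * suc d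
≤⇒cross {q} {n} {d} m e q≃ q≤ = ℤ.drop‿+≤+ (subst₂ ℤ._≤_ (sym (ℤ.pos-* n (suc e))) (sym (ℤ.pos-* m (suc d)))
  (ℚᵘ.drop-*≤* (begin
    mkℚᵘ (+ n) d           ≃⟨ ℚᵘ.≃-sym q≃ ⟩
    toℚᵘ q                 ≤⟨ ℚ.toℚᵘ-mono-≤ q≤ ⟩
    toℚᵘ (+ m ℚ./ suc e)   ≃⟨ toℚᵘ-/ (+ m) e ⟩
    mkℚᵘ (+ m) e           ∎)))
  where open ℚᵘ.≤-Reasoning

cross⇒≤ : ∀ {q n d} m e → toℚᵘ q ℚᵘ.≃ mkℚᵘ (+ n) d → m * suc d ≤ n * suc e → + m ℚ./ suc e ℚ.≤ q
cross⇒≤ {q} {n} {d} m e q≃ le = ℚ.toℚᵘ-cancel-≤ (begin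
    toℚᵘ (+ m ℚ./ suc e)   ≃⟨ toℚᵘ-/ (+ m) e ⟩
    mkℚᵘ (+ m) e           ≤⟨ *≤* (subst₂ ℤ._≤_ (ℤ.pos-* m (suc d)) (ℤ.pos-* n (suc e)) (ℤ.+≤+ le)) ⟩
    mkℚᵘ (+ n) d           ≃⟨ ℚᵘ.≃-sym q≃ ⟩
    toℚᵘ q                 ∎)
  where open ℚᵘ.≤-Reasoning

-- The quantity 2q − b of LeHalfSqrt and HalfSqrtLt.
twice-minus : ℕ → ℚ → ℚ
twice-minus b q = (+ 2 ℚ./ 1) ℚ.* q ℚ.- (+ b ℚ./ 1)

twice-minus-mono : ∀ b {p q} → p ℚ.≤ q → twice-minus b p ℚ.≤ twice-minus b q
twice-minus-mono b p≤q = ℚ.+-monoˡ-≤ (ℚ.- (+ b ℚ./ 1)) (ℚ.*-monoˡ-≤-nonNeg (+ 2 ℚ./ 1) p≤q)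

square-mono : ∀ {s t} → 0ℚ ℚ.≤ s → s ℚ.≤ t → s ℚ.* s ℚ.≤ t ℚ.* t
square-mono {s} {t} 0≤s s≤t = ℚ.≤-trans
  (ℚ.*-monoˡ-≤-nonNeg s {{ℚ.nonNegative 0≤s}} s≤t)
  (ℚ.*-monoʳ-≤-nonNeg t {{ℚ.nonNegative (ℚ.≤-trans 0≤s s≤t)}} s≤t)

LeHalfSqrt-antitone : ∀ a b {p q} → p ℚ.≤ q → LeHalfSqrt a b q → LeHalfSqrt a b p
LeHalfSqrt-antitone a b {p} {q} p≤q (inj₁ t≤0) = inj₁ (ℚ.≤-trans (twice-minus-mono b p≤q) t≤0)
LeHalfSqrt-antitone a b {p} {q} p≤q (inj₂ t²≤a) with ℚ.≤-total (twice-minus b p) 0ℚ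
... | inj₁ ≤0 = inj₁ ≤0
... | inj₂ 0≤ = inj₂ (ℚ.≤-trans (square-mono 0≤ (twice-minus-mono b p≤q)) t²≤a)

HalfSqrtLt-mono : ∀ a b {p q} → p ℚ.≤ q → HalfSqrtLt a b p → HalfSqrtLt a b q
HalfSqrtLt-mono a b p≤q (0<t , a<t²) =
  ℚ.<-≤-trans 0<t (twice-minus-mono b p≤q) ,
  ℚ.<-≤-trans a<t² (square-mono (ℚ.<⇒≤ 0<t) (twice-minus-mono b p≤q))

twice-minus-≃ : ∀ b q n d → toℚᵘ q ℚᵘ.≃ mkℚᵘ n d →
  toℚᵘ (twice-minus b q) ℚᵘ.≃ mkℚᵘ (+ 2 ℤ.* n ℤ.- + b ℤ.* + suc d) d
twice-minus-≃ b q n d q≃ = begin-equality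
  toℚᵘ (two ℚ.* q ℚ.- β′)                       ≃⟨ ℚ.toℚᵘ-homo-+ (two ℚ.* q) (ℚ.- β′) ⟩
  toℚᵘ (two ℚ.* q) ℚᵘ.+ toℚᵘ (ℚ.- β′)           ≃⟨ ℚᵘ.+-cong (ℚ.toℚᵘ-homo-* two q) (ℚ.toℚᵘ-homo‿- β′) ⟩
  toℚᵘ two ℚᵘ.* toℚᵘ q ℚᵘ.- toℚᵘ β′             ≃⟨ ℚᵘ.+-cong (ℚᵘ.*-congˡ {toℚᵘ two} q≃) (ℚᵘ.-‿cong (toℚᵘ-/ (+ b) 0)) ⟩
  mkℚᵘ (+ 2) 0 ℚᵘ.* mkℚᵘ n d ℚᵘ.- mkℚᵘ (+ b) 0  ≃⟨ *≡* (ident (+ b) n (+ suc d)) ⟩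
  mkℚᵘ (+ 2 ℤ.* n ℤ.- + b ℤ.* + suc d) d        ∎
  where
  open ℚᵘ.≤-Reasoning
  two = + 2 ℚ./ 1
  β′ = + b ℚ./ 1
  ident : ∀ b n e → (+ 2 ℤ.* n ℤ.* + 1 ℤ.+ (ℤ.- b) ℤ.* (+ 1 ℤ.* e)) ℤ.* e
    ≡ (+ 2 ℤ.* n ℤ.- b ℤ.* e) ℤ.* (+ 1 ℤ.* e ℤ.* + 1)
  ident = ℤSolver.solve-∀

-- The discriminant (r - 2)² + 12 r of f² + (2 - r) f - 3 r; the values at 1, 2, 3 are 13, 24, 37.
discriminant : ℕ → ℕ
discriminant r = r * r + 8 * r + 4

square-≃ : ∀ t n d → toℚᵘ t ℚᵘ.≃ mkℚᵘ n d → toℚᵘ (t ℚ.* t) ℚᵘ.≃ mkℚᵘ n d ℚᵘ.* mkℚᵘ n d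
square-≃ t n d t≃ = ℚᵘ.≃-trans (ℚ.toℚᵘ-homo-* t t) (ℚᵘ.*-cong t≃ t≃)

-- For t = 2 q - (r + 4) = 2 f + 2 - r, completing the square gives t² + 4 (r f + 3 r - f² - 2 f) =
-- `discriminant r`. The bracket, times D², is the slack `k` of `Quadratic`.
quadratic⇒LeHalfSqrt : ∀ r q F d → toℚᵘ q ℚᵘ.≃ mkℚᵘ (+ (3 * suc d + F)) d →
  Quadratic r (suc d) F → LeHalfSqrt (discriminant r) (r + 4) q
quadratic⇒LeHalfSqrt r q F d q≃ L≤R = inj₂ (ℚ.toℚᵘ-cancel-≤ (begin
  toℚᵘ (t ℚ.* t)                     ≃⟨ square-≃ t T d (twice-minus-≃ (r + 4) q N d q≃) ⟩
  mkℚᵘ T d ℚᵘ.* mkℚᵘ T d             ≤⟨ *≤* T²≤ ⟩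
  mkℚᵘ (+ discriminant r) 0          ≃⟨ ℚᵘ.≃-sym (toℚᵘ-/ (+ discriminant r) 0) ⟩
  toℚᵘ (+ discriminant r ℚ./ 1)      ∎))
  where
  open ℚᵘ.≤-Reasoning
  D k L : ℕ
  D = suc d
  L = F * F + 2 * (D * F)
  k = (r * (D * F) + 3 * r * (D * D)) ∸ L
  N T : ℤ
  N = + (3 * D + F)
  T = + 2 ℤ.* N ℤ.- + (r + 4) ℤ.* + D
  t = twice-minus (r + 4) q
  pos-*³ : ∀ x y z → + (x * (y * z)) ≡ + x ℤ.* (+ y ℤ.* + z)
  pos-*³ x y z = trans (ℤ.pos-* x (y * z)) (cong (+ x ℤ.*_) (ℤ.pos-* y z))
  slack : + F ℤ.* + F ℤ.+ + 2 ℤ.* (+ D ℤ.* + F) ℤ.+ + k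
    ≡ + r ℤ.* (+ D ℤ.* + F) ℤ.+ + 3 ℤ.* + r ℤ.* (+ D ℤ.* + D)
  slack = trans (cong (ℤ._+ + k) (sym (cong₂ ℤ._+_ (ℤ.pos-* F F) (pos-*³ 2 D F))))
    (trans (cong +_ (m+[n∸m]≡n L≤R))
      (cong₂ ℤ._+_ (pos-*³ r D F) (trans (pos-*³ (3 * r) D D) (cong (ℤ._* (+ D ℤ.* + D)) (ℤ.pos-* 3 r)))))
  ident : ∀ r D F → let T = + 2 ℤ.* (+ 3 ℤ.* D ℤ.+ F) ℤ.- (r ℤ.+ + 4) ℤ.* D in
    T ℤ.* T ℤ.* + 1 ℤ.+ + 4 ℤ.* (r ℤ.* (D ℤ.* F) ℤ.+ + 3 ℤ.* r ℤ.* (D ℤ.* D)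
                                   ℤ.- (F ℤ.* F ℤ.+ + 2 ℤ.* (D ℤ.* F)))
      ≡ (r ℤ.* r ℤ.+ + 8 ℤ.* r ℤ.+ + 4) ℤ.* (D ℤ.* D)
  ident r D F = ℤSolver.solve (r ∷ D ∷ F ∷ [])
  cancel : ∀ L k → L ℤ.+ k ℤ.- L ≡ k
  cancel L k = ℤSolver.solve (L ∷ k ∷ [])
  k≡ : + k ≡ + r ℤ.* (+ D ℤ.* + F) ℤ.+ + 3 ℤ.* + r ℤ.* (+ D ℤ.* + D) ℤ.- (+ F ℤ.* + F ℤ.+ + 2 ℤ.* (+ D ℤ.* + F))
  k≡ = trans (sym (cancel (+ F ℤ.* + F ℤ.+ + 2 ℤ.* (+ D ℤ.* + F)) (+ k))) (cong (ℤ._- (+ F ℤ.* + F ℤ.+ + 2 ℤ.* (+ D ℤ.* + F))) slack)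
  total : T ℤ.* T ℤ.* + 1 ℤ.+ + 4 ℤ.* + k ≡ + discriminant r ℤ.* + (D * D)
  total = trans
    (cong₂ (λ M j → let U = + 2 ℤ.* (M ℤ.+ + F) ℤ.- (+ r ℤ.+ + 4) ℤ.* + D in U ℤ.* U ℤ.* + 1 ℤ.+ + 4 ℤ.* j)
      (ℤ.pos-* 3 D) k≡)
    (trans (ident (+ r) (+ D) (+ F))
      (cong₂ (λ x y → (x ℤ.+ y ℤ.+ + 4) ℤ.* + (D * D)) (sym (ℤ.pos-* r r)) (sym (ℤ.pos-* 8 r))))
  T²≤ : T ℤ.* T ℤ.* + 1 ℤ.≤ + discriminant r ℤ.* + (D * D)
  T²≤ = subst (λ z → T ℤ.* T ℤ.* + 1 ℤ.≤ z) (trans (cong (λ j → T ℤ.* T ℤ.* + 1 ℤ.+ j) (ℤ.pos-* 4 k)) total)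
    (ℤ.i≤i+j (T ℤ.* T ℤ.* + 1) (+ (4 * k)))

-- The hypothesis on `A` and `C` says that f = (r + 1) (A + C) / A lies beyond the positive root: T²
-- - `disc` A² is 4 (r + 1) times the difference of its two sides.
supercritical⇒HalfSqrtLt : ∀ r q a C → let A = suc a in
  toℚᵘ q ℚᵘ.≃ mkℚᵘ (+ (3 * A + suc r * (A + C))) a →
  A * A < (3 + r) * (A * C) + suc r * (C * C) →
  HalfSqrtLt (discriminant (suc r)) (suc r + 4) q
supercritical⇒HalfSqrtLt r q a C q≃ A²< =
  ℚ.toℚᵘ-cancel-< (begin-strict
    mkℚᵘ (+ 0) 0                ≡⟨⟩
    toℚᵘ 0ℚ                     <⟨ *<* (ℤ.+<+ (s≤s z≤n)) ⟩
    mkℚᵘ (+ T) a                ≃⟨ ℚᵘ.≃-sym t≃ ⟩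
    toℚᵘ t                      ∎) ,
  ℚ.toℚᵘ-cancel-< (begin-strict
    toℚᵘ (+ disc ℚ./ 1)         ≃⟨ toℚᵘ-/ (+ disc) 0 ⟩
    mkℚᵘ (+ disc) 0             <⟨ *<* (subst₂ ℤ._<_ (ℤ.pos-* disc (A * A)) (trans (ℤ.pos-* (T * T) 1) (cong (ℤ._* + 1) (ℤ.pos-* T T))) (ℤ.+<+ T²>)) ⟩
    mkℚᵘ (+ T) a ℚᵘ.* mkℚᵘ (+ T) a ≃⟨ ℚᵘ.≃-sym (square-≃ t (+ T) a t≃) ⟩
    toℚᵘ (t ℚ.* t)              ∎)
  where
  open ℚᵘ.≤-Reasoning
  A T disc : ℕ
  A = suc a
  T = (3 + r) * A + 2 * (suc r * C)
  disc = discriminant (suc r)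
  t = twice-minus (suc r + 4) q
  natural : ∀ r A C → (3 + r) * A + 2 * (suc r * C) + (suc r + 4) * A
    ≡ 2 * (3 * A + suc r * (A + C))
  natural r A C = solve (r ∷ A ∷ C ∷ [])
  cancel : ∀ x y → x ℤ.+ y ℤ.- y ≡ x
  cancel x y = ℤSolver.solve (x ∷ y ∷ [])
  T≡ : + 2 ℤ.* + (3 * A + suc r * (A + C)) ℤ.- + (suc r + 4) ℤ.* + A ≡ + T
  T≡ = trans (cong₂ ℤ._-_ (trans (sym (ℤ.pos-* 2 (3 * A + suc r * (A + C)))) (cong +_ (sym (natural r A C))))
               (sym (ℤ.pos-* (suc r + 4) A)))
             (cancel (+ T) (+ ((suc r + 4) * A)))
  t≃ : toℚᵘ t ℚᵘ.≃ mkℚᵘ (+ T) a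
  t≃ = subst (λ n → toℚᵘ t ℚᵘ.≃ mkℚᵘ n a) T≡ (twice-minus-≃ (suc r + 4) q _ a q≃)
  T²> : disc * (A * A) < T * T * 1
  T²> = linear (3 + 4 * r) ((4 * suc r) ⊗ A²<) (ident r A C)
    where
    ident : ∀ r A C → let T = (3 + r) * A + 2 * (suc r * C) in
      suc ((suc r * suc r + 8 * suc r + 4) * (A * A))
        + 4 * suc r * ((3 + r) * (A * C) + suc r * (C * C)) + (3 + 4 * r)
      ≡ T * T * 1 + 4 * suc r * suc (A * A)
    ident r A C = solve (r ∷ A ∷ C ∷ [])

-- The upper bound for δ(c)

-- For q ≤ 3 the claim follows by monotonicity from the case F = 0, where the quadratic is trivial;
-- any other q has the form 3 + F / D.
quadratics⇒LeHalfSqrt : ∀ r q →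
  (∀ F d → toℚᵘ q ℚᵘ.≃ mkℚᵘ (+ (3 * suc d + F)) d → Quadratic r (suc d) F) →
  LeHalfSqrt (discriminant r) (r + 4) q
quadratics⇒LeHalfSqrt r q@(mkℚ n d _) quadratic with q ℚ.≤? (+ 3 ℚ./ 1)
... | yes q≤3 = LeHalfSqrt-antitone (discriminant r) (r + 4) q≤3
  (quadratic⇒LeHalfSqrt r (+ 3 ℚ./ 1) 0 0 (*≡* refl) z≤n)
... | no q≰3 = above n refl
  where
  above : ∀ n′ → n′ ≡ n → LeHalfSqrt (discriminant r) (r + 4) q
  above -[1+ n′ ] refl = ⊥-elim (q≰3 (ℚ.*≤* ℤ.-≤+))
  above (+ n′) refl with 3 * suc d ≤? n′
  ... | no n≱ = ⊥-elim (q≰3 (ℚ.*≤* (subst₂ ℤ._≤_ (ℤ.pos-* n′ 1) (ℤ.pos-* 3 (suc d))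
                  (ℤ.+≤+ (≤-trans (≤-reflexive (*-identityʳ n′)) (≰⇒≥ n≱))))))
  ... | yes n≥ = quadratic⇒LeHalfSqrt r q (n′ ∸ 3 * suc d) d q≃ (quadratic (n′ ∸ 3 * suc d) d q≃)
    where
    q≃ : toℚᵘ q ℚᵘ.≃ mkℚᵘ (+ (3 * suc d + (n′ ∸ 3 * suc d))) d
    q≃ = subst (λ m → toℚᵘ q ℚᵘ.≃ mkℚᵘ (+ m) d) (sym (m+[n∸m]≡n n≥)) ℚᵘ.≃-refl

δα-ratioBound : ∀ α {u} F d → u ≤ length (xsOf α) → toℚᵘ (δα α) ℚᵘ.≃ mkℚᵘ (+ (3 * suc d + F)) d →
  RatioBound (shifted α) u (minPair (ysOf α)) (suc d) F
δα-ratioBound α F d u≤ q≃ (suc i) _ i<u = ≤-trans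
  (≤⇒cross (nth (xsOf α) i + β α) i q≃ (minRatio-lower (β α) 0 (xsOf α) i (<-≤-trans i<u u≤)))
  (≤-reflexive (trans (*-comm _ (suc d)) (cong (suc d *_) (+-suc (nth (xsOf α) i) _))))

minPair-ys-lower : ∀ α {r} → count l2 α ≡ r → ∀ i j → i + j ≡ r →
  minPair (ysOf α) ≤ nth (ysOf α) i + nth (ysOf α) j
minPair-ys-lower α count≡ i j i+j≡ = minPair-lower (ysOf α) i j
  (trans (+-suc i j) (trans (cong suc (trans i+j≡ (sym count≡))) (proj₂ (trajectory-length α (final-trajectory α)))))

upper₄ : ∀ α → count l2 α ≡ 3 → LeHalfSqrt 13 5 (δα α)
upper₄ α count≡ with extract α count≡
... | A , s , u , y₁≤A , u≤ , profile = quadratics⇒LeHalfSqrt 1 (δα α) λ F d q≃ →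
  quadratic₄ profile (minPair (ysOf α)) (suc d) F (δα-ratioBound α F d u≤ q≃)
    (≤-trans (minPair-ys-lower α count≡ 1 2 refl) (+-monoˡ-≤ _ y₁≤A))

upper₅ : ∀ α → count l2 α ≡ 4 → LeHalfSqrt 24 6 (δα α)
upper₅ α count≡ with extract α count≡
... | A , s , u , y₁≤A , u≤ , profile = quadratics⇒LeHalfSqrt 2 (δα α) λ F d q≃ →
  quadratic₅ profile (minPair (ysOf α)) (suc d) F (δα-ratioBound α F d u≤ q≃)
    (≤-trans (minPair-ys-lower α count≡ 1 3 refl) (+-monoˡ-≤ _ y₁≤A))
    (minPair-ys-lower α count≡ 2 2 refl)

upper₆ : ∀ α → count l2 α ≡ 5 → LeHalfSqrt 37 7 (δα α)
upper₆ α count≡ with extract α count≡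
... | A , s , u , y₁≤A , u≤ , profile = quadratics⇒LeHalfSqrt 3 (δα α) λ F d q≃ →
  quadratic₆ profile (minPair (ysOf α)) (suc d) F (δα-ratioBound α F d u≤ q≃) (minPair-ys-lower α count≡ 2 3 refl)

-- The lower bound for δ(c)

-- From here on c = 4 + r, so that the r of Quadratic is suc r.
word : ℕ → ℕ → ℕ → List Letter
word a C r = replicate a l1 ++ l2 ∷ replicate C l1 ++ l2 ∷ replicate C l1 ++ l2 ∷ replicate r l2

count-l2-block : ∀ k α → count l2 (replicate k l1 ++ l2 ∷ α) ≡ suc (count l2 α)
count-l2-block zero α = refl
count-l2-block (suc k) α = count-l2-block k α

count-l1-tail : ∀ r → count l1 (replicate r l2) ≡ 0
count-l1-tail zero = refl
count-l1-tail (suc r) = count-l1-tail r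

count-l2-tail : ∀ r → count l2 (replicate r l2) ≡ r
count-l2-tail zero = refl
count-l2-tail (suc r) = cong suc (count-l2-tail r)

length-count : ∀ α → length α ≡ count l1 α + count l2 α
length-count [] = refl
length-count (l1 ∷ α) = cong suc (length-count α)
length-count (l2 ∷ α) = trans (cong suc (length-count α)) (sym (+-suc _ _))

last-∷ : ∀ (x {y} : Letter) α → last α ≡ just y → last (x ∷ α) ≡ just y
last-∷ _ (_ ∷ _) eq = eq

last-block : ∀ {y} k α → last (l2 ∷ α) ≡ just y → last (replicate k l1 ++ l2 ∷ α) ≡ just y
last-block zero α eq = eq
last-block (suc k) α eq = last-∷ l1 (replicate k l1 ++ l2 ∷ α) (last-block k α eq)

last-tail : ∀ r → last (l2 ∷ replicate r l2) ≡ just l2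
last-tail zero = refl
last-tail (suc r) = last-tail r

count-l2-word : ∀ a C r → count l2 (word a C r) ≡ 3 + r
count-l2-word a C r = trans (count-l2-block a _) (cong suc (trans (count-l2-block C _)
  (cong suc (trans (count-l2-block C _) (cong suc (count-l2-tail r))))))

word-InSet : ∀ a C r → InSet (4 + r) (word a C r)
word-InSet a C r = suc (count l1 α) , s≤s z≤n ,
  (trans (length-count α) (trans (cong (λ n → count l1 α + n) count≡) (ident (count l1 α))) , refl , count≡) ,
  last-block a α₁ (last-∷ l2 α₁ (last-block C α₂ (last-∷ l2 α₂ (last-block C (replicate r l2) (last-tail r)))))
  where
  α₂ = replicate C l1 ++ l2 ∷ replicate r l2
  α₁ = replicate C l1 ++ l2 ∷ α₂
  α = word a C r
  count≡ = count-l2-word a C r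
  ident : ∀ n → n + (3 + r) ≡ n + (4 + r) ∸ 1
  ident n = sym (cong (_∸ 1) (+-suc n (3 + r)))

-- A discrete intermediate value theorem. It supplies the block length `C` that is still subcritical
-- while C + 1 is supercritical.
crossing : ∀ (f : ℕ → ℕ) t n → f 0 ≤ t → t < f n → ∃[ c ] f c ≤ t × t < f (suc c)
crossing f t zero f0≤t t<f0 = ⊥-elim (<⇒≱ t<f0 f0≤t)
crossing f t (suc n) f0≤t t<f with f n ≤? t
... | yes fn≤t = n , fn≤t , t<f
... | no fn≰t = crossing f t n f0≤t (≰⇒> fn≰t)

-- Growth of the two sequences along the word

minPairOf-xs-≥ : ∀ xs n → 1 ≤ n → n ≤ length xs → (∀ i → i < n → i ≤ nth xs i) → n ≤ suc (minPairOf xs n)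
minPairOf-xs-≥ xs (suc n) 1≤n n≤ below = s≤s (minPairOf-greatest xs n≤ 1≤n λ i j eq →
  ≤-trans (≤-reflexive (sym (suc-injective (trans (sym (+-suc i j)) eq))))
    (below i (subst (i <_) eq (m<m+n i (s≤s z≤n))) ⊕ below j (subst (j <_) eq (m≤n+m (suc j) i))))

-- If i + j = n - 1, then x_i ≥ i and x_j ≥ j add up to n - 1, and the strict inequality supplies
-- the missing unit.
xs-growth : ∀ xs u → u ≤ length xs → (∀ i → 1 ≤ i → i < u → minPairOf xs i < nth xs i) →
  ∀ i → i < u → i ≤ nth xs i
xs-growth xs u u≤ step i i<u = below (suc i) i<u i ≤-refl
  where
  below : ∀ n → n ≤ u → ∀ i → i < n → i ≤ nth xs i
  below (suc n) n<u i (s≤s i≤n) with i ≟ n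
  ... | no i≢n = below n (<⇒≤ n<u) i (≤∧≢⇒< i≤n i≢n)
  below (suc zero) n<u zero _ | yes refl = z≤n
  below (suc (suc n)) n<u _ _ | yes refl = ≤-trans
    (minPairOf-xs-≥ xs (suc n) (s≤s z≤n) (≤-trans (<⇒≤ n<u) u≤) (below (suc n) (<⇒≤ n<u)))
    (step (suc n) (s≤s z≤n) n<u)

floor : ℕ → ℕ → ℕ → ℕ
floor A s zero = 0
floor A s (suc p) = p * s + A

-- Two positive indices with sum p + 2 always contribute p s + 2 A. A pair with index 0 contributes
-- (p + 1) s + A, which is no smaller since A ≤ s.
minPairOf-ys-≥ : ∀ {A s} ys p → A ≤ s → 3 + p ≤ length ys → (∀ i → i < 3 + p → floor A s i ≤ nth ys i) →
  p * s + 2 * A ≤ minPairOf ys (3 + p)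
minPairOf-ys-≥ {A} {s} ys p A≤s p≤ below = minPairOf-greatest ys p≤ (s≤s z≤n) λ i j eq →
  ≤-trans (splits i j (suc-injective (trans (sym (+-suc i j)) eq)))
    (below i (subst (i <_) eq (m<m+n i (s≤s z≤n))) ⊕ below j (subst (j <_) eq (m≤n+m (suc j) i)))
  where
  end : p * s + 2 * A ≤ suc p * s + A
  end = linear 0 A≤s (ident p s A)
    where
    ident : ∀ p s A → p * s + 2 * A + s + 0 ≡ suc p * s + A + A
    ident p s A = solve (p ∷ s ∷ A ∷ [])
  splits : ∀ i j → i + j ≡ 2 + p → p * s + 2 * A ≤ floor A s i + floor A s j
  splits zero _ refl = end
  splits (suc i) zero eq rewrite trans (sym (+-identityʳ i)) (suc-injective eq) =
    ≤-trans end (≤-reflexive (sym (+-identityʳ _)))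
  splits (suc i) (suc j) eq = ≤-reflexive
    (trans (cong (λ n → n * s + 2 * A) (sym (suc-injective (suc-injective (trans (cong suc (sym (+-suc i j))) eq)))))
      (ident i j s A))
    where
    ident : ∀ i j s A → (i + j) * s + 2 * A ≡ i * s + A + (j * s + A)
    ident i j s A = solve (i ∷ j ∷ s ∷ A ∷ [])

extend-below : ∀ {f g : ℕ → ℕ} m → f m ≤ g m → (∀ i → i < m → f i ≤ g i) → ∀ i → i < suc m → f i ≤ g i
extend-below m fm≤gm below i (s≤s i≤m) with i ≟ m
... | yes refl = fm≤gm
... | no i≢m = below i (≤∧≢⇒< i≤m i≢m)

-- A further letter 2 yields at least u + (p s + 2 A), and 2 s ≤ u + A turns this into (p + 2) s +
-- A.
ys-tail : ∀ {A s u xs ys} k p → A ≤ s → 2 * s ≤ u + A → u ≤ suc (minPairOf xs u) →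
  Trajectory xs ys u (3 + p) (replicate k l2) → (∀ i → i < 3 + p → floor A s i ≤ nth ys i) →
  ∀ i → i < 3 + (p + k) → floor A s i ≤ nth ys i
ys-tail zero p A≤s 2s≤ u≤ _ below i i< = below i (subst (λ q → i < 3 + q) (+-identityʳ p) i<)
ys-tail {A} {s} {u} {xs} {ys} (suc k) p A≤s 2s≤ u≤ (y≡ , t) below i i< =
  ys-tail k (suc p) A≤s 2s≤ u≤ t (extend-below (3 + p) new below) i (subst (λ q → i < 3 + q) (+-suc p k) i<)
  where
  p≤ : 3 + p ≤ length ys
  p≤ = ≤-trans (m≤m+n (3 + p) _) (≤-trans (+-monoʳ-≤ (3 + p) (n≤1+n _)) (≤-reflexive (proj₂ (trajectory-length {xs} {ys} (l2 ∷ replicate k l2) (y≡ , t)))))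
  new : (2 + p) * s + A ≤ nth ys (3 + p)
  new = linear 0 (≤-reflexive (sym y≡) ⊕ u≤ ⊕ minPairOf-ys-≥ ys p A≤s p≤ below ⊕ 2s≤)
    (ident A s u p (nth ys (3 + p)) (minPairOf xs u) (minPairOf ys (3 + p)))
    where
    ident : ∀ A s u p y P Q → (2 + p) * s + A + (y + suc P + Q + (u + A)) + 0
      ≡ y + (suc (P + Q) + u + (p * s + 2 * A) + 2 * s)
    ident A s u p y P Q = solve (A ∷ s ∷ u ∷ p ∷ y ∷ P ∷ Q ∷ [])

module WordBounds (a C r : ℕ) where
  A s u : ℕ
  A = a + 1
  s = C + A
  u = C + s

  α : List Letter
  α = word a C r

  xs ys : List ℕ
  xs = xsOf α
  ys = ysOf α

  private
    phase₁ = phase a (final-trajectory α)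
    phase₂ = phase C (proj₂ (proj₂ phase₁))
    phase₃ = phase C (proj₂ (proj₂ phase₂))

  A≤s : A ≤ s
  A≤s = m≤n+m A C

  s≤u : s ≤ u
  s≤u = m≤n+m s C

  length-xs : length xs ≡ u
  length-xs = trans (sym (proj₁ (trajectory-length (replicate r l2) (proj₂ (proj₂ phase₃)))))
    (trans (cong (λ n → u + n) (count-l1-tail r)) (+-identityʳ u))

  length-ys : length ys ≡ 4 + r
  length-ys = trans (sym (proj₂ (trajectory-length (replicate r l2) (proj₂ (proj₂ phase₃)))))
    (cong (λ n → 4 + n) (count-l2-tail r))

  xs-value : ∀ i → 1 ≤ i → i < u → ∃[ m ] nth xs i ≡ suc (minPairOf xs i + minPairOf ys m)
  xs-value i 1≤i i<u with i <? A | i <? s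
  ... | yes i<A | _ = 1 , proj₁ phase₁ i 1≤i i<A
  ... | no i≮A | yes i<s = 2 , proj₁ phase₂ i (≮⇒≥ i≮A) i<s
  ... | no i≮A | no i≮s = 3 , proj₁ phase₃ i (≮⇒≥ i≮s) i<u

  xs-≥ : ∀ i → i < u → i ≤ nth xs i
  xs-≥ = xs-growth xs u (≤-reflexive (sym length-xs)) λ i 1≤i i<u →
    ≤-trans (s≤s (m≤m+n _ _)) (≤-reflexive (sym (proj₂ (xs-value i 1≤i i<u))))

  minPair-xs-≥ : ∀ n → 1 ≤ n → n ≤ u → n ≤ suc (minPairOf xs n)
  minPair-xs-≥ n 1≤n n≤u = minPairOf-xs-≥ xs n 1≤n (≤-trans n≤u (≤-reflexive (sym length-xs)))
    (λ i i<n → xs-≥ i (<-≤-trans i<n n≤u))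

  value-≥ : ∀ {v n} m {M} → v ≡ suc (minPairOf xs n + minPairOf ys m) → 1 ≤ n → n ≤ u → M ≤ minPairOf ys m → n + M ≤ v
  value-≥ {v} {n} m {M} v≡ 1≤n n≤u M≤ = ≤-trans (minPair-xs-≥ n 1≤n n≤u ⊕ M≤) (≤-reflexive (sym v≡))

  1≤A : 1 ≤ A
  1≤A = m≤n+m 1 a

  1≤s : 1 ≤ s
  1≤s = ≤-trans 1≤A A≤s

  1≤u : 1 ≤ u
  1≤u = ≤-trans 1≤s s≤u

  below₂ : ∀ i → i < 2 → floor A s i ≤ nth ys i
  below₂ zero _ = z≤n
  below₂ (suc zero) _ = ≤-trans (m≤m+n A 0) (value-≥ 1 (proj₁ (proj₂ phase₁)) 1≤A (≤-trans A≤s s≤u) z≤n)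
  below₂ (suc (suc i)) (s≤s (s≤s ()))

  -- With two entries every pair contains index 0, so the bound is `A`; the general estimate starts
  -- at three entries.
  minPair-ys₂ : A ≤ minPairOf ys 2
  minPair-ys₂ = minPairOf-greatest ys (≤-trans (m≤m+n 2 _) (≤-reflexive (sym length-ys))) (s≤s z≤n) λ
    { zero .1 refl → ≤-trans (below₂ 1 (s≤s (s≤s z≤n))) (m≤n+m _ _)
    ; (suc zero) zero refl → ≤-trans (below₂ 1 (s≤s (s≤s z≤n))) (m≤m+n _ _)
    ; (suc zero) (suc j) ()
    ; (suc (suc i)) j eq → ⊥-elim (1+n≢0 (trans (sym (+-suc i j)) (suc-injective (suc-injective eq))))
    }

  below₃ : ∀ i → i < 3 → floor A s i ≤ nth ys i
  below₃ = extend-below 2 (≤-trans (≤-reflexive (cong (_+ A) (*-identityˡ s)))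
    (value-≥ 2 (proj₁ (proj₂ phase₂)) 1≤s s≤u minPair-ys₂)) below₂

  minPair-ys₃ : 2 * A ≤ minPairOf ys 3
  minPair-ys₃ = minPairOf-ys-≥ ys 0 A≤s (≤-trans (m≤m+n 3 _) (≤-reflexive (sym length-ys))) below₃

  -- An equality, because the second and third blocks of letters 1 have the same length.
  2s≤u+A : 2 * s ≤ u + A
  2s≤u+A = ≤-reflexive (ident A C)
    where
    ident : ∀ A C → 2 * (C + A) ≡ C + (C + A) + A
    ident A C = solve (A ∷ C ∷ [])

  below₄ : ∀ i → i < 4 → floor A s i ≤ nth ys i
  below₄ = extend-below 3 (linear 0 (value-≥ 3 (proj₁ (proj₂ phase₃)) 1≤u ≤-refl minPair-ys₃ ⊕ 2s≤u+A)
    (ident A s u (nth ys 3))) below₃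
    where
    ident : ∀ A s u y → 2 * s + A + (y + (u + A)) + 0 ≡ y + (u + 2 * A + 2 * s)
    ident A s u y = solve (A ∷ s ∷ u ∷ y ∷ [])

  β-≥ : suc (suc r * s + 2 * A) ≤ β α
  β-≥ = s≤s (subst (suc r * s + 2 * A ≤_) (cong minPair (take-all (4 + r) ys (≤-reflexive length-ys)))
    (minPairOf-ys-≥ ys (suc r) A≤s (≤-reflexive (sym length-ys))
      (ys-tail {xs = xs} r 1 A≤s 2s≤u+A (minPair-xs-≥ u 1≤u ≤-refl) (proj₂ (proj₂ phase₃)) below₄)))

  -- After cancellation the three phases require i + 1 ≤ A, then (2 A + (r + 1) s) C ≤ A², which is
  -- `subcritical`, and finally twice that inequality: at u both the distance 2 C from A and the
  -- cost 2 A have doubled.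
  ratio-≥ : (3 + r) * (A * C) + suc r * (C * C) ≤ A * A → ∀ i → i < length xs →
    (3 * A + suc r * s) * suc i ≤ (nth xs i + β α) * A
  ratio-≥ subcritical i i< with i <? A | i <? s
  ... | yes i<A | _ = linear 0 (A ⊗ (xs-≥ i i<u ⊕ β-≥) ⊕ (2 * A + suc r * s) ⊗ i<A)
    (ident A s r i (nth xs i) (β α))
    where
    i<u = subst (i <_) length-xs i<
    ident : ∀ A s r i x b →
      (3 * A + suc r * s) * suc i + (A * (x + b) + (2 * A + suc r * s) * A) + 0
        ≡ (x + b) * A + (A * (i + suc (suc r * s + 2 * A)) + (2 * A + suc r * s) * suc i)
    ident A s r i x b = solve (A ∷ s ∷ r ∷ i ∷ x ∷ b ∷ [])
  ... | no i≮A | yes i<s = linear 0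
    (A ⊗ (value-≥ 2 (proj₁ phase₂ i (≮⇒≥ i≮A) i<s) (≤-trans 1≤A (≮⇒≥ i≮A)) (≤-trans (<⇒≤ i<s) s≤u) minPair-ys₂ ⊕ β-≥)
      ⊕ (2 * A + suc r * s) ⊗ i<s ⊕ subcritical)
    (ident A C r i (nth xs i) (β α))
    where
    ident : ∀ A C r i x b → let s = C + A in
      (3 * A + suc r * s) * suc i + (A * (x + b) + (2 * A + suc r * s) * s + A * A) + 0
        ≡ (x + b) * A + (A * (i + A + suc (suc r * s + 2 * A)) + (2 * A + suc r * s) * suc i
                         + ((3 + r) * (A * C) + suc r * (C * C)))
    ident A C r i x b = solve (A ∷ C ∷ r ∷ i ∷ x ∷ b ∷ [])
  ... | no i≮A | no i≮s = linear 0
    (A ⊗ (value-≥ 3 (proj₁ phase₃ i (≮⇒≥ i≮s) i<u) (≤-trans 1≤s (≮⇒≥ i≮s)) (<⇒≤ i<u) minPair-ys₃ ⊕ β-≥)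
      ⊕ (2 * A + suc r * s) ⊗ i<u ⊕ 2 ⊗ subcritical)
    (ident A C r i (nth xs i) (β α))
    where
    i<u = subst (i <_) length-xs i<
    ident : ∀ A C r i x b → let s = C + A in
      (3 * A + suc r * s) * suc i + (A * (x + b) + (2 * A + suc r * s) * (C + s) + 2 * (A * A)) + 0
        ≡ (x + b) * A + (A * (i + 2 * A + suc (suc r * s + 2 * A)) + (2 * A + suc r * s) * suc i
                         + 2 * ((3 + r) * (A * C) + suc r * (C * C)))
    ident A C r i x b = solve (A ∷ C ∷ r ∷ i ∷ x ∷ b ∷ [])

δα-≥ : ∀ a C r → let A = suc a in (3 + r) * (A * C) + suc r * (C * C) ≤ A * A →
  + (3 * A + suc r * (C + A)) ℚ./ A ℚ.≤ δα (word a C r)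
δα-≥ a C r subcritical = minRatio-greatest (β α) 0 xs (≤-trans 1≤u (≤-reflexive (sym length-xs))) λ i i< →
  cross⇒≤ (3 * suc a + suc r * (C + suc a)) a (toℚᵘ-/ (+ (nth xs i + β α)) i)
    (subst (λ A → (3 * A + suc r * (C + A)) * suc i ≤ (nth xs i + β α) * A) (+-comm a 1)
      (ratio-≥ (subst (λ A → (3 + r) * (A * C) + suc r * (C * C) ≤ A * A) (+-comm 1 a) subcritical) i i<))
  where open WordBounds a C r

-- Parameters for a given ε

lower : ∀ r ε → 0ℚ ℚ.< ε →
  ∃[ α ] InSet (4 + r) α × HalfSqrtLt (discriminant (suc r)) (suc r + 4) (δα α ℚ.+ ε)
lower r (mkℚ (+ zero) d _) (ℚ.*<* (ℤ.+<+ ()))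
lower r (mkℚ -[1+ n ] d _) (ℚ.*<* ())
lower r ε@(mkℚ (+ suc n) d _) _ with crossing (λ C → (3 + r) * (A * C) + suc r * (C * C)) (A * A) A f0≤ f>
  where
  -- This makes (r + 1) / A = 1 / (d + 1) ≤ ε, and (r + 1) / A is the change of the ratio when `C`
  -- grows by one.
  A = suc r * suc d
  f0≤ : (3 + r) * (A * 0) + suc r * (0 * 0) ≤ A * A
  f0≤ = ≤-trans (≤-reflexive (ident r A)) z≤n
    where
    ident : ∀ r A → (3 + r) * (A * 0) + suc r * (0 * 0) ≡ 0
    ident r A = solve (r ∷ A ∷ [])
  f> : A * A < (3 + r) * (A * A) + suc r * (A * A)
  f> = linear ((2 + 2 * r) * (A * A)) (*-mono-≤ {1} {A} (s≤s z≤n) (s≤s z≤n)) (ident r A)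
    where
    ident : ∀ r A → suc (A * A) + A * A + (2 + 2 * r) * (A * A) ≡ (3 + r) * (A * A) + suc r * (A * A) + 1 * 1
    ident r A = solve (r ∷ A ∷ [])
... | C , subcritical , supercritical = word a C r , word-InSet a C r ,
  HalfSqrtLt-mono (discriminant (suc r)) (suc r + 4) (ℚ.+-mono-≤ (δα-≥ a C r subcritical) ρ≤ε)
    (supercritical⇒HalfSqrtLt r (v ℚ.+ ρ) a (suc C) v+ρ≃ supercritical)
  where
  a A : ℕ
  -- Chosen so that `suc a` reduces to `suc r * suc d`.
  a = d + r * suc d
  A = suc a
  v ρ : ℚ
  v = + (3 * A + suc r * (C + A)) ℚ./ A
  ρ = + suc r ℚ./ A
  ρ≤ε : ρ ℚ.≤ ε
  ρ≤ε = cross⇒≤ (suc r) a ℚᵘ.≃-refl (m≤m+n A (n * A))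
  v+ρ≃ : toℚᵘ (v ℚ.+ ρ) ℚᵘ.≃ mkℚᵘ (+ (3 * A + suc r * (A + suc C))) a
  v+ρ≃ = ℚᵘ.≃-trans (ℚ.toℚᵘ-homo-+ v ρ) (ℚᵘ.≃-trans
    (ℚᵘ.+-cong (toℚᵘ-/ (+ N) a) (toℚᵘ-/ (+ suc r) a))
    (subst (λ M → mkℚᵘ (+ N) a ℚᵘ.+ mkℚᵘ (+ suc r) a ℚᵘ.≃ mkℚᵘ (+ M) a) (numerator r A C)
      (*≡* (common-denominator (+ N) (+ suc r) (+ A)))))
    where
    N : ℕ
    N = 3 * A + suc r * (C + A)
    numerator : ∀ r A C → 3 * A + suc r * (C + A) + suc r ≡ 3 * A + suc r * (A + suc C)
    numerator r A C = solve (r ∷ A ∷ C ∷ [])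
    common-denominator : ∀ x y z → (x ℤ.* z ℤ.+ y ℤ.* z) ℤ.* z ≡ (x ℤ.+ y) ℤ.* (z ℤ.* z)
    common-denominator x y z = ℤSolver.solve (x ∷ y ∷ z ∷ [])

theorem6 : DeltaEq 4 13 5 × DeltaEq 5 24 6 × DeltaEq 6 37 7
theorem6 = ((λ { α (_ , _ , (_ , _ , count≡) , _) → upper₄ α count≡ }) , lower 0)
         , ((λ { α (_ , _ , (_ , _ , count≡) , _) → upper₅ α count≡ }) , lower 1)
         , ((λ { α (_ , _ , (_ , _ , count≡) , _) → upper₆ α count≡ }) , lower 2)
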